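{- In every categorical model of the plain language, the interpretation $[\![-]\!]_u$ preserves judgemental equality: if $\Gamma\vdash s=t:A$ is derivable in the plain language, then $[\![s]\!]_u=[\![t]\!]_u$ as morphisms $[\![\Gamma]\!]_u\to[\![A]\!]_u$.
   Context: Fix a set $\mathbf{Q}$ of qubits and a set $\mathbf{G}$ of gates; each gate $G$ acts on a tuple $(q_1,\dots,q_n)$ of distinct qubits (durations play no role here). **Plain language.** Types: $A,B::=1\mid q\mid A\otimes B$ ($q\in\mathbf{Q}$). Contexts: lists of declarations $x:A$ with distinct variables. Terms: $x$, $*$, $\mathrm{let}\ *=s\ \mathrm{in}\ t$, $G(t_1,\dots,t_n)$, $(s,t)$, $\mathrm{let}\ (x,y)=s\ \mathrm{in}\ t$, $\mathrm{let}\ x=s\ \mathrm{in}\ t$. Typing rules: - Swap: from $\Gamma,x:A,y:B,\Delta\vdash t:C$ infer $\Gamma,y:B,x:A,\Delta\vdash t:C$. - Var: $x:A\vdash x:A$. Unit-I: $\vdash *:1$. - Unit-E: from $\Gamma\vdash s:1$, $\Delta\vdash t:A$ infer $\Gamma,\Delta\vdash\mathrm{let}\ *=s\ \mathrm{in}\ t:A$. - Gate: from $\Gamma_i\vdash t_i:q_i$ ($1\le i\le n$) infer $\Gamma_1,\dots,\Gamma_n\vdash G(t_1,\dots,t_n):q_1\otimes\cdots\otimes q_n$. - Tens-I: from $\Gamma\vdash s:A$, $\Delta\vdash t:B$ infer $\Gamma,\Delta\vdash(s,t):A\otimes B$. - Tens-E: from $\Gamma\vdash s:A\otimes B$ and $x:A,y:B,\Delta\vdash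 t:C$ infer $\Gamma,\Delta\vdash\mathrm{let}\ (x,y)=s\ \mathrm{in}\ t:C$. - Let: from $\Gamma\vdash s:A$ and $x:A,\Delta\vdash t:C$ infer $\Gamma,\Delta\vdash\mathrm{let}\ x=s\ \mathrm{in}\ t:C$. **Judgemental equality** $\Gamma\vdash s=t:A$ is the least equivalence relation on well-typed terms (up to renaming of bound variables) that is a congruence for all constructors and contains, whenever both sides are well typed with the same context and type and no variable capture occurs: - $\beta$: $(\mathrm{let}\ *=*\ \mathrm{in}\ t)=t$; $(\mathrm{let}\ (x,y)=(s,t)\ \mathrm{in}\ u)=u[x:=s,y:=t]$; $(\mathrm{let}\ x=s\ \mathrm{in}\ t)=t[x:=s]$. - $\eta$: $(\mathrm{let}\ *=t\ \mathrm{in}\ *)=t$; $(\mathrm{let}\ (x,y)=t\ \mathrm{in}\ (x,y))=t$. - Commuting conversions, for patterns $P,R$ each of the form $*$ or $(x,y)$: $(\mathrm{let}\ P=s\ \mathrm{in\ let}\ R=t\ \mathrm{in}\ u)=(\mathrm{let}\ R=(\mathrm{let}\ P=s\ \mathrm{in}\ t)\ \mathrm{in}\ u)$; $(\mathrm{let}\ P=s\ \mathrm{in\ let}\ R=t\ \mathrm{in}\ u)=(\mathrm{let}\ R=t\ \mathrm{in\ let}\ P=s\ \mathrm{in}\ u)$; $(\mathrm{let}\ P=s\ \mathrm{in}\ G(t_1,\dots,t_n))=G(t_1,\dots,\mathrm{let}\ P=s\ \mathrm{in}\ t_i,\dots,t_n)$; $(\mathrm{let}\ P=s\ \mathrm{in}\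 (t,u))=(\mathrm{let}\ P=s\ \mathrm{in}\ t,\,u)$ and $=(t,\,\mathrm{let}\ P=s\ \mathrm{in}\ u)$. **Models.** A categorical model of the plain language is a symmetric monoidal category $\mathcal{C}^\otimes$ with an object $X_q$ for each $q\in\mathbf{Q}$ and, for each gate $G$ acting on $(q_1,\dots,q_n)$, a morphism $f_G:\bigotimes_{i=1}^nX_{q_i}\to\bigotimes_{i=1}^nX_{q_i}$. **Interpretation.** $[\![1]\!]_u=I$, $[\![q]\!]_u=X_q$, $[\![A\otimes B]\!]_u=[\![A]\!]_u\otimes[\![B]\!]_u$; $[\![[]]\!]_u=I$, $[\![x:A,\Gamma]\!]_u=[\![A]\!]_u\otimes[\![\Gamma]\!]_u$. A derivation of $\Gamma\vdash t:A$ is interpreted as a morphism $[\![t]\!]_u:[\![\Gamma]\!]_u\to[\![A]\!]_u$ (inserting canonical coherence isomorphisms): Swap is precomposition with the symmetry; Var and Unit-I are identities; Unit-E and Tens-I are $[\![s]\!]_u\otimes[\![t]\!]_u$; Tens-E and Let are $[\![t]\!]_u\circ([\![s]\!]_u\otimes\mathrm{Id}_{[\![\Delta]\!]_u})$; Gate is $f_G\circ\bigotimes_i[\![t_i]\!]_u$. -}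

module Defs where

open import Level using (Level; suc; _⊔_)
open import Data.Bool using (if_then_else_)
open import Data.Fin using (Fin)
open import Data.List using (List; []; _∷_; _++_; map)
open import Data.List.Membership.Propositional using (_∈_; _∉_)
open import Data.List.Relation.Binary.Disjoint.Propositional using (Disjoint)
open import Data.List.Relation.Unary.All using (All)
open import Data.List.Relation.Unary.Unique.Propositional using (Unique)
open import Data.Nat using (ℕ; _≟_)
open import Data.List.Membership.DecPropositional _≟_ using (_∈?_)
open import Data.Product using (_×_; _,_; proj₁)
open import Data.Sum using (_⊎_)
open import Data.Unit using (⊤)
open import Data.Empty using (⊥)
open import Data.Vec as Vec using (Vec; []; _∷_; lookup; _[_]≔_)
import Data.Vec.Relation.Unary.Unique.Propositional as VecUnique
open import Relation.Binary.Core using (Rel)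
open import Relation.Binary.PropositionalEquality using (_≡_; _≢_)
open import Relation.Binary.Structures using (IsEquivalence)
open import Relation.Nullary using (¬_; does)

------------------------------------------------------------------------
-- Symmetric monoidal categories, with a setoid equality on morphisms

record Category (o ℓ e : Level) : Set (suc (o ⊔ ℓ ⊔ e)) where
  infix  4 _≈_ _⇒_
  infixr 9 _∘_
  field
    Obj : Set o
    _⇒_ : Obj → Obj → Set ℓ
    _≈_ : ∀ {A B} → Rel (A ⇒ B) e
    id  : ∀ {A} → A ⇒ A
    _∘_ : ∀ {A B C} → B ⇒ C → A ⇒ B → A ⇒ C

    isEquivalence : ∀ {A B} → IsEquivalence (_≈_ {A} {B})
    ∘-cong    : ∀ {A B C} {f f′ : B ⇒ C} {g g′ : A ⇒ B} →
                f ≈ f′ → g ≈ g′ → f ∘ g ≈ f′ ∘ g′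
    assoc     : ∀ {A B C D} {f : A ⇒ B} {g : B ⇒ C} {h : C ⇒ D} →
                (h ∘ g) ∘ f ≈ h ∘ (g ∘ f)
    identityˡ : ∀ {A B} {f : A ⇒ B} → id ∘ f ≈ f
    identityʳ : ∀ {A B} {f : A ⇒ B} → f ∘ id ≈ f

record SymmetricMonoidalCategory (o ℓ e : Level) : Set (suc (o ⊔ ℓ ⊔ e)) where
  field
    category : Category o ℓ e
  open Category category public

  infixr 10 _⊗₀_ _⊗₁_
  field
    I    : Obj
    _⊗₀_ : Obj → Obj → Obj
    _⊗₁_ : ∀ {A B C D} → A ⇒ B → C ⇒ D → A ⊗₀ C ⇒ B ⊗₀ D

    ⊗-cong : ∀ {A B C D} {f f′ : A ⇒ B} {g g′ : C ⇒ D} →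
             f ≈ f′ → g ≈ g′ → f ⊗₁ g ≈ f′ ⊗₁ g′
    ⊗-id   : ∀ {A B} → id {A} ⊗₁ id {B} ≈ id
    ⊗-∘    : ∀ {A B C A′ B′ C′} {f : A ⇒ B} {g : B ⇒ C}
               {f′ : A′ ⇒ B′} {g′ : B′ ⇒ C′} →
             (g ∘ f) ⊗₁ (g′ ∘ f′) ≈ (g ⊗₁ g′) ∘ (f ⊗₁ f′)

    λ⇒ : ∀ {A} → I ⊗₀ A ⇒ A
    λ⇐ : ∀ {A} → A ⇒ I ⊗₀ A
    ρ⇒ : ∀ {A} → A ⊗₀ I ⇒ A
    ρ⇐ : ∀ {A} → A ⇒ A ⊗₀ I
    α⇒ : ∀ {A B C} → (A ⊗₀ B) ⊗₀ C ⇒ A ⊗₀ (B ⊗₀ C)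
    α⇐ : ∀ {A B C} → A ⊗₀ (B ⊗₀ C) ⇒ (A ⊗₀ B) ⊗₀ C
    γ  : ∀ {A B} → A ⊗₀ B ⇒ B ⊗₀ A

    λ-isoˡ : ∀ {A} → λ⇐ ∘ λ⇒ {A} ≈ id
    λ-isoʳ : ∀ {A} → λ⇒ {A} ∘ λ⇐ ≈ id
    ρ-isoˡ : ∀ {A} → ρ⇐ ∘ ρ⇒ {A} ≈ id
    ρ-isoʳ : ∀ {A} → ρ⇒ {A} ∘ ρ⇐ ≈ id
    α-isoˡ : ∀ {A B C} → α⇐ ∘ α⇒ {A} {B} {C} ≈ id
    α-isoʳ : ∀ {A B C} → α⇒ {A} {B} {C} ∘ α⇐ ≈ id

    λ-natural : ∀ {A B} {f : A ⇒ B} → λ⇒ ∘ (id ⊗₁ f) ≈ f ∘ λ⇒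
    ρ-natural : ∀ {A B} {f : A ⇒ B} → ρ⇒ ∘ (f ⊗₁ id) ≈ f ∘ ρ⇒
    α-natural : ∀ {A B C A′ B′ C′} {f : A ⇒ A′} {g : B ⇒ B′} {h : C ⇒ C′} →
                α⇒ ∘ ((f ⊗₁ g) ⊗₁ h) ≈ (f ⊗₁ (g ⊗₁ h)) ∘ α⇒
    γ-natural : ∀ {A B A′ B′} {f : A ⇒ A′} {g : B ⇒ B′} →
                γ ∘ (f ⊗₁ g) ≈ (g ⊗₁ f) ∘ γ

    triangle : ∀ {A B} → (id {A} ⊗₁ λ⇒ {B}) ∘ α⇒ ≈ ρ⇒ ⊗₁ id
    pentagon : ∀ {A B C D} →
               (id {A} ⊗₁ α⇒ {B} {C} {D}) ∘ α⇒ ∘ (α⇒ ⊗₁ id) ≈ α⇒ ∘ α⇒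
    symmetry : ∀ {A B} → γ {B} {A} ∘ γ ≈ id
    hexagon  : ∀ {A B C} →
               (id {B} ⊗₁ γ {A} {C}) ∘ α⇒ ∘ (γ ⊗₁ id) ≈ α⇒ ∘ γ ∘ α⇒

  ⨂₀ : ∀ {n} → Vec Obj n → Obj
  ⨂₀ []           = I
  ⨂₀ (A ∷ [])     = A
  ⨂₀ (A ∷ B ∷ As) = A ⊗₀ ⨂₀ (B ∷ As)

------------------------------------------------------------------------
-- The plain language

record Signature : Set₁ where
  field
    Qubit    : Set
    Gate     : Set
    arity    : Gate → ℕ
    acts     : (g : Gate) → Vec Qubit (arity g)
    distinct : ∀ g → VecUnique.Unique (acts g)

Var : Set
Var = ℕ

module Language (S : Signature) where
  open Signature S

  infixr 7 _⊗_
  data Ty : Set where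
    𝟙     : Ty
    qubit : Qubit → Ty
    _⊗_   : Ty → Ty → Ty

  ⨂ : ∀ {n} → Vec Qubit n → Ty
  ⨂ []            = 𝟙
  ⨂ (q ∷ [])      = qubit q
  ⨂ (q ∷ q′ ∷ qs) = qubit q ⊗ ⨂ (q′ ∷ qs)

  Ctx : Set
  Ctx = List (Var × Ty)

  Distinct : Ctx → Set
  Distinct Γ = Unique (map proj₁ Γ)

  data Pattern : Set where
    ✶   : Pattern
    _,_ : Var → Var → Pattern

  vars : Pattern → List Var
  vars ✶       = []
  vars (x , y) = x ∷ y ∷ []

  -- Raw terms with named variables; α-conversion is part of the judgemental
  -- equality below. letᵖ destructs a pattern, let binds a single variable.
  infix 5 letᵖ[_≔_]_ let[_≔_]_
  data Term : Set where
    var        : Var → Term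
    ✶          : Term
    gate       : (g : Gate) → Vec Term (arity g) → Term
    pair       : Term → Term → Term
    letᵖ[_≔_]_ : Pattern → Term → Term → Term
    let[_≔_]_  : Var → Term → Term → Term

  infix 4 _∈fv_ _∈fv*_ _#_
  mutual
    _∈fv_ : Var → Term → Set
    z ∈fv var x             = z ≡ x
    z ∈fv ✶                 = ⊥
    z ∈fv gate g ts         = z ∈fv* ts
    z ∈fv pair s t          = z ∈fv s ⊎ z ∈fv t
    z ∈fv (letᵖ[ P ≔ s ] t) = z ∈fv s ⊎ (z ∉ vars P × z ∈fv t)
    z ∈fv (let[ x ≔ s ] t)  = z ∈fv s ⊎ (z ≢ x × z ∈fv t)

    _∈fv*_ : ∀ {n} → Var → Vec Term n → Set
    z ∈fv* []       = ⊥
    z ∈fv* (t ∷ ts) = z ∈fv t ⊎ z ∈fv* ts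

  _#_ : List Var → Term → Set
  xs # t = All (λ x → ¬ x ∈fv t) xs

  -- Parallel substitutions; var is the identity.
  Subst : Set
  Subst = Var → Term

  infixl 6 _[_↦_]
  _[_↦_] : Subst → Var → Term → Subst
  (σ [ x ↦ s ]) z = if does (z ≟ x) then s else σ z

  _∖_ : Subst → List Var → Subst
  (σ ∖ xs) z = if does (z ∈? xs) then var z else σ z

  -- Bound variables are not renamed, so this is the intended operation only
  -- under NoCapture.
  mutual
    subst : Subst → Term → Term
    subst σ (var x)           = σ x
    subst σ ✶                 = ✶
    subst σ (gate g ts)       = gate g (subst* σ ts)
    subst σ (pair s t)        = pair (subst σ s) (subst σ t)
    subst σ (letᵖ[ P ≔ s ] t)  = letᵖ[ P ≔ subst σ s ] subst (σ ∖ vars P) t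
    subst σ (let[ x ≔ s ] t)  = let[ x ≔ subst σ s ] subst (σ ∖ (x ∷ [])) t

    subst* : ∀ {n} → Subst → Vec Term n → Vec Term n
    subst* σ []       = []
    subst* σ (t ∷ ts) = subst σ t ∷ subst* σ ts

  -- Under a binder for xs, the terms substituted for the remaining free
  -- variables of t must not mention xs.
  NoCaptureUnder : List Var → Subst → Term → Set
  NoCaptureUnder xs σ t = ∀ z → z ∈fv t → z ∉ xs → xs # σ z

  mutual
    NoCapture : Subst → Term → Set
    NoCapture σ (var x)       = ⊤
    NoCapture σ ✶             = ⊤
    NoCapture σ (gate g ts)   = NoCapture* σ ts
    NoCapture σ (pair s t)    = NoCapture σ s × NoCapture σ t
    NoCapture σ (letᵖ[ P ≔ s ] t) =
      NoCapture σ s × NoCaptureUnder (vars P) σ t × NoCapture (σ ∖ vars P) t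
    NoCapture σ (let[ x ≔ s ] t) =
      NoCapture σ s × NoCaptureUnder (x ∷ []) σ t × NoCapture (σ ∖ (x ∷ [])) t

    NoCapture* : ∀ {n} → Subst → Vec Term n → Set
    NoCapture* σ []       = ⊤
    NoCapture* σ (t ∷ ts) = NoCapture σ t × NoCapture* σ ts

  -- The Distinct premises say that the concluding context is a context; every
  -- derivable Γ ⊢ t ∶ A then has Distinct Γ.
  infix 3 _⊢_∶_ _⊢*_∶_
  mutual
    data _⊢_∶_ : Ctx → Term → Ty → Set where
      swap  : ∀ Γ {x y A B Δ t C} →
              Γ ++ (x , A) ∷ (y , B) ∷ Δ ⊢ t ∶ C →
              Γ ++ (y , B) ∷ (x , A) ∷ Δ ⊢ t ∶ C
      var   : ∀ {x A} → (x , A) ∷ [] ⊢ var x ∶ A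
      unitI : [] ⊢ ✶ ∶ 𝟙
      unitE : ∀ {Γ Δ s t A} → Distinct (Γ ++ Δ) →
              Γ ⊢ s ∶ 𝟙 → Δ ⊢ t ∶ A → Γ ++ Δ ⊢ letᵖ[ ✶ ≔ s ] t ∶ A
      gate  : ∀ {Γ} g {ts} → Distinct Γ →
              Γ ⊢* ts ∶ acts g → Γ ⊢ gate g ts ∶ ⨂ (acts g)
      tensI : ∀ {Γ Δ s t A B} → Distinct (Γ ++ Δ) →
              Γ ⊢ s ∶ A → Δ ⊢ t ∶ B → Γ ++ Δ ⊢ pair s t ∶ A ⊗ B
      tensE : ∀ {Γ Δ x y s t A B C} → Distinct (Γ ++ Δ) →
              Γ ⊢ s ∶ A ⊗ B → (x , A) ∷ (y , B) ∷ Δ ⊢ t ∶ C →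
              Γ ++ Δ ⊢ letᵖ[ x , y ≔ s ] t ∶ C
      letE  : ∀ {Γ Δ x s t A C} → Distinct (Γ ++ Δ) →
              Γ ⊢ s ∶ A → (x , A) ∷ Δ ⊢ t ∶ C →
              Γ ++ Δ ⊢ let[ x ≔ s ] t ∶ C

    data _⊢*_∶_ : ∀ {n} → Ctx → Vec Term n → Vec Qubit n → Set where
      []  : [] ⊢* [] ∶ []
      _∷_ : ∀ {Γ Δ t q n} {ts : Vec Term n} {qs : Vec Qubit n} →
            Γ ⊢ t ∶ qubit q → Δ ⊢* ts ∶ qs → Γ ++ Δ ⊢* t ∷ ts ∶ q ∷ qs

  -- Generating equations between raw terms, each with the side condition that
  -- no variable is captured. The first two are renamings of bound variables.
  infix 4 _↝_
  data _↝_ : Term → Term → Set where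
    α-let⊗ : ∀ {x y x′ y′ s t} →
             let σ = var [ x ↦ var x′ ] [ y ↦ var y′ ] in
             (∀ z → z ∈ x′ ∷ y′ ∷ [] → z ∈fv t → z ∈ x ∷ y ∷ []) →
             NoCapture σ t →
             (letᵖ[ x , y ≔ s ] t) ↝ (letᵖ[ x′ , y′ ≔ s ] subst σ t)
    α-let  : ∀ {x x′ s t} →
             let σ = var [ x ↦ var x′ ] in
             (x′ ∈fv t → x′ ≡ x) →
             NoCapture σ t →
             (let[ x ≔ s ] t) ↝ (let[ x′ ≔ s ] subst σ t)

    β-𝟙    : ∀ {t} → (letᵖ[ ✶ ≔ ✶ ] t) ↝ t
    β-⊗    : ∀ {x y s t u} →
             let σ = var [ x ↦ s ] [ y ↦ t ] in
             NoCapture σ u →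
             (letᵖ[ x , y ≔ pair s t ] u) ↝ subst σ u
    β-let  : ∀ {x s t} →
             let σ = var [ x ↦ s ] in
             NoCapture σ t →
             (let[ x ≔ s ] t) ↝ subst σ t

    η-𝟙    : ∀ {t} → (letᵖ[ ✶ ≔ t ] ✶) ↝ t
    η-⊗    : ∀ {x y t} → (letᵖ[ x , y ≔ t ] pair (var x) (var y)) ↝ t

    cc-nest  : ∀ P R {s t u} →
               (∀ z → z ∈ vars P → z ∈fv u → z ∈ vars R) →
               (letᵖ[ P ≔ s ] letᵖ[ R ≔ t ] u) ↝
               (letᵖ[ R ≔ (letᵖ[ P ≔ s ] t) ] u)
    cc-exch  : ∀ P R {s t u} →
               Disjoint (vars P) (vars R) → vars P # t → vars R # s →
               (letᵖ[ P ≔ s ] letᵖ[ R ≔ t ] u) ↝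
               (letᵖ[ R ≔ t ] letᵖ[ P ≔ s ] u)
    cc-gate  : ∀ P g (i : Fin (arity g)) {s ts} →
               (∀ j → j ≢ i → vars P # lookup ts j) →
               (letᵖ[ P ≔ s ] gate g ts) ↝
               gate g (ts [ i ]≔ (letᵖ[ P ≔ s ] lookup ts i))
    cc-pairˡ : ∀ P {s t u} → vars P # u →
               (letᵖ[ P ≔ s ] pair t u) ↝ pair (letᵖ[ P ≔ s ] t) u
    cc-pairʳ : ∀ P {s t u} → vars P # t →
               (letᵖ[ P ≔ s ] pair t u) ↝ pair t (letᵖ[ P ≔ s ] u)

  infix 3 _⊢_≐_∶_ _⊢*_≐_∶_
  mutual
    data _⊢_≐_∶_ : Ctx → Term → Term → Ty → Set where
      axiom : ∀ {Γ s t A} → Γ ⊢ s ∶ A → Γ ⊢ t ∶ A → s ↝ t → Γ ⊢ s ≐ t ∶ A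

      refl  : ∀ {Γ t A} → Γ ⊢ t ∶ A → Γ ⊢ t ≐ t ∶ A
      sym   : ∀ {Γ s t A} → Γ ⊢ s ≐ t ∶ A → Γ ⊢ t ≐ s ∶ A
      trans : ∀ {Γ s t u A} → Γ ⊢ s ≐ t ∶ A → Γ ⊢ t ≐ u ∶ A → Γ ⊢ s ≐ u ∶ A

      swap  : ∀ Γ {x y A B Δ s t C} →
              Γ ++ (x , A) ∷ (y , B) ∷ Δ ⊢ s ≐ t ∶ C →
              Γ ++ (y , B) ∷ (x , A) ∷ Δ ⊢ s ≐ t ∶ C
      unitE : ∀ {Γ Δ s s′ t t′ A} → Distinct (Γ ++ Δ) →
              Γ ⊢ s ≐ s′ ∶ 𝟙 → Δ ⊢ t ≐ t′ ∶ A →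
              Γ ++ Δ ⊢ letᵖ[ ✶ ≔ s ] t ≐ letᵖ[ ✶ ≔ s′ ] t′ ∶ A
      gate  : ∀ {Γ} g {ts ts′} → Distinct Γ →
              Γ ⊢* ts ≐ ts′ ∶ acts g → Γ ⊢ gate g ts ≐ gate g ts′ ∶ ⨂ (acts g)
      tensI : ∀ {Γ Δ s s′ t t′ A B} → Distinct (Γ ++ Δ) →
              Γ ⊢ s ≐ s′ ∶ A → Δ ⊢ t ≐ t′ ∶ B →
              Γ ++ Δ ⊢ pair s t ≐ pair s′ t′ ∶ A ⊗ B
      tensE : ∀ {Γ Δ x y s s′ t t′ A B C} → Distinct (Γ ++ Δ) →
              Γ ⊢ s ≐ s′ ∶ A ⊗ B → (x , A) ∷ (y , B) ∷ Δ ⊢ t ≐ t′ ∶ C →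
              Γ ++ Δ ⊢ letᵖ[ x , y ≔ s ] t ≐ letᵖ[ x , y ≔ s′ ] t′ ∶ C
      letE  : ∀ {Γ Δ x s s′ t t′ A C} → Distinct (Γ ++ Δ) →
              Γ ⊢ s ≐ s′ ∶ A → (x , A) ∷ Δ ⊢ t ≐ t′ ∶ C →
              Γ ++ Δ ⊢ let[ x ≔ s ] t ≐ let[ x ≔ s′ ] t′ ∶ C

    data _⊢*_≐_∶_ : ∀ {n} → Ctx → Vec Term n → Vec Term n → Vec Qubit n → Set where
      []  : [] ⊢* [] ≐ [] ∶ []
      _∷_ : ∀ {Γ Δ t t′ q n} {ts ts′ : Vec Term n} {qs : Vec Qubit n} →
            Γ ⊢ t ≐ t′ ∶ qubit q → Δ ⊢* ts ≐ ts′ ∶ qs →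
            Γ ++ Δ ⊢* t ∷ ts ≐ t′ ∷ ts′ ∶ q ∷ qs

------------------------------------------------------------------------
-- Categorical models and the interpretation

record Model (S : Signature) (o ℓ e : Level) : Set (suc (o ⊔ ℓ ⊔ e)) where
  open Signature S
  open Language S
  field
    smc : SymmetricMonoidalCategory o ℓ e
  open SymmetricMonoidalCategory smc public
  field
    X : Qubit → Obj
    f : (g : Gate) → ⨂₀ (Vec.map X (acts g)) ⇒ ⨂₀ (Vec.map X (acts g))

  ⟦_⟧ᵗ : Ty → Obj
  ⟦ 𝟙 ⟧ᵗ       = I
  ⟦ qubit q ⟧ᵗ = X q
  ⟦ A ⊗ B ⟧ᵗ   = ⟦ A ⟧ᵗ ⊗₀ ⟦ B ⟧ᵗ

  ⟦_⟧ᶜ : Ctx → Obj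
  ⟦ [] ⟧ᶜ          = I
  ⟦ (x , A) ∷ Γ ⟧ᶜ = ⟦ A ⟧ᵗ ⊗₀ ⟦ Γ ⟧ᶜ

  split : ∀ Γ {Δ} → ⟦ Γ ++ Δ ⟧ᶜ ⇒ ⟦ Γ ⟧ᶜ ⊗₀ ⟦ Δ ⟧ᶜ
  split []      = λ⇐
  split (_ ∷ Γ) = α⇐ ∘ (id ⊗₁ split Γ)

  exchange : ∀ Γ {x y A B Δ} →
             ⟦ Γ ++ (y , B) ∷ (x , A) ∷ Δ ⟧ᶜ ⇒ ⟦ Γ ++ (x , A) ∷ (y , B) ∷ Δ ⟧ᶜ
  exchange []      = α⇒ ∘ (γ ⊗₁ id) ∘ α⇐
  exchange (_ ∷ Γ) = id ⊗₁ exchange Γ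

  cons : ∀ q {n} (qs : Vec Qubit n) →
         X q ⊗₀ ⨂₀ (Vec.map X qs) ⇒ ⨂₀ (Vec.map X (q ∷ qs))
  cons q []      = ρ⇒
  cons q (_ ∷ _) = id

  -- The identity, up to the propositional equality of its endpoints.
  canonical : ∀ {n} (qs : Vec Qubit n) → ⨂₀ (Vec.map X qs) ⇒ ⟦ ⨂ qs ⟧ᵗ
  canonical []            = id
  canonical (q ∷ [])      = id
  canonical (q ∷ q′ ∷ qs) = id ⊗₁ canonical (q′ ∷ qs)

  mutual
    ⟦_⟧ : ∀ {Γ t A} → Γ ⊢ t ∶ A → ⟦ Γ ⟧ᶜ ⇒ ⟦ A ⟧ᵗ
    ⟦ swap Γ d ⟧              = ⟦ d ⟧ ∘ exchange Γ
    ⟦ var ⟧                   = ρ⇒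
    ⟦ unitI ⟧                 = id
    ⟦ unitE {Γ = Γ} _ d d′ ⟧  = λ⇒ ∘ (⟦ d ⟧ ⊗₁ ⟦ d′ ⟧) ∘ split Γ
    ⟦ gate g _ ds ⟧           = canonical (acts g) ∘ f g ∘ ⟦ ds ⟧*
    ⟦ tensI {Γ = Γ} _ d d′ ⟧  = (⟦ d ⟧ ⊗₁ ⟦ d′ ⟧) ∘ split Γ
    ⟦ tensE {Γ = Γ} _ d d′ ⟧  = ⟦ d′ ⟧ ∘ α⇒ ∘ (⟦ d ⟧ ⊗₁ id) ∘ split Γ
    ⟦ letE {Γ = Γ} _ d d′ ⟧   = ⟦ d′ ⟧ ∘ (⟦ d ⟧ ⊗₁ id) ∘ split Γ

    ⟦_⟧* : ∀ {n Γ} {ts : Vec Term n} {qs} →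
           Γ ⊢* ts ∶ qs → ⟦ Γ ⟧ᶜ ⇒ ⨂₀ (Vec.map X qs)
    ⟦ [] ⟧* = id
    ⟦ _∷_ {Γ = Γ} {q = q} {qs = qs} d ds ⟧* =
      cons q qs ∘ (⟦ d ⟧ ⊗₁ ⟦ ds ⟧*) ∘ split Γ

{-# OPTIONS --safe #-}
module Submission where

-- A structural map between trees of typed variables is a composite of
-- associators, unitors and symmetries.  Pulling a variable to the front of its
-- tree is natural in structural maps, so removing variables one at a time shows
-- that between trees with distinct variables there is at most one structural
-- map up to ≈.  A term uses exactly the variables of its context, so two
-- derivations of the same judgement split the context in the same way up to a
-- structural map and have equal interpretations.  Each generating equation is
-- then checked on one convenient derivation of its right-hand side: a let
-- becomes plain composition, the β- and α-rules follow from the substitution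
-- lemma, and the commuting conversions from the naturality of structural maps.

-- Judgemental equality relates terms, and a term has many derivations: Swap may be inserted
-- anywhere, and it alters the splits made by the other rules. Transitivity then meets two unrelated
-- derivations of its middle term, and the theorem itself quantifies over all derivations of both
-- sides. Independence of the derivation is thus the main obstacle; once it is known, `≐-sound` only
-- has to find some pair of derivations with equal meanings. Lists fit this badly, since a split of
-- a list is a concatenation and a reordering is a chain of exchanges. In a tree with brackets and
-- units, reordering, rebracketing and splitting are all maps `S ⟿ T`, and every rule can absorb
-- one. Coherence for symmetric monoidal categories compares maps with the same underlying
-- permutation. Here the distinct names determine that permutation, so no permutations are handled.
-- A second obstacle is that a `let` does not record the type of the term it binds, so uniqueness of
-- types has to precede any comparison of meanings.

open import Defs
open import Data.Bool using (if_then_else_)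
open import Data.Empty using (⊥; ⊥-elim)
open import Data.Fin using (Fin; zero; suc)
open import Data.List using (List; []; _∷_; _++_; map)
open import Data.List.Membership.Propositional using () renaming (_∈_ to _∈ᴸ_; _∉_ to _∉ᴸ_)
open import Data.List.Relation.Unary.All as All using (All; []; _∷_)
open import Data.List.Relation.Unary.AllPairs using ([]; _∷_)
open import Data.List.Relation.Unary.Any using (here; there)
open import Data.Nat using (ℕ; zero; suc; _+_; _≟_)
open import Data.Nat.Properties using (+-suc; suc-injective)
open import Data.List.Membership.DecPropositional _≟_ using (_∈?_)
open import Data.Product using (Σ; ∃; _×_; _,_; proj₁; proj₂)
open import Data.Sum using (_⊎_; inj₁; inj₂)
open import Data.Unit using (⊤; tt)
open import Data.Vec as Vec using (Vec; []; _∷_; lookup; _[_]≔_)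
open import Relation.Binary.Bundles using (Setoid)
open import Relation.Binary.PropositionalEquality
  using (_≡_; _≢_; refl; sym; trans; cong) renaming (subst to ≡-subst)
import Relation.Binary.Reasoning.Setoid as SetoidReasoning
open import Relation.Binary.Structures using (IsEquivalence)
open import Relation.Nullary using (yes; no)
open import Relation.Nullary.Decidable using (dec-true; dec-false)

-- Consequences of the symmetric monoidal axioms

module SMC {o ℓ e} (C : SymmetricMonoidalCategory o ℓ e) where
  open SymmetricMonoidalCategory C public

  hom : Obj → Obj → Setoid ℓ e
  hom A B = record { Carrier = A ⇒ B ; _≈_ = _≈_ ; isEquivalence = isEquivalence }

  module ≈-Reasoning {A B : Obj} where
    open SetoidReasoning (hom A B) public

  module _ {A B : Obj} where
    open IsEquivalence (isEquivalence {A} {B}) public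
      using () renaming (refl to ≈-refl; sym to ≈-sym; trans to ≈-trans)

  private variable
    A B D E : Obj
    f g h k f′ g′ f⁻¹ g⁻¹ : A ⇒ B

  open ≈-Reasoning

  infixr 4 _⟩∘⟨_ refl⟩∘⟨_
  infixl 5 _⟩∘⟨refl
  infixr 8 _⇉_

  _⟩∘⟨_ : f ≈ f′ → g ≈ g′ → f ∘ g ≈ f′ ∘ g′
  _⟩∘⟨_ = ∘-cong

  refl⟩∘⟨_ : f ≈ f′ → g ∘ f ≈ g ∘ f′
  refl⟩∘⟨ p = ∘-cong ≈-refl p

  _⟩∘⟨refl : f ≈ f′ → f ∘ g ≈ f′ ∘ g
  p ⟩∘⟨refl = ∘-cong p ≈-refl

  _⇉_ : f ≈ f′ → g ≈ g′ → f ⊗₁ g ≈ f′ ⊗₁ g′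
  _⇉_ = ⊗-cong

  pullˡ : f ∘ g ≈ h → f ∘ (g ∘ k) ≈ h ∘ k
  pullˡ p = ≈-trans (≈-sym assoc) (p ⟩∘⟨refl)

  pushˡ : h ≈ f ∘ g → h ∘ k ≈ f ∘ (g ∘ k)
  pushˡ p = ≈-trans (p ⟩∘⟨refl) assoc

  extendˡ : f ∘ g ≈ f′ ∘ g′ → f ∘ (g ∘ h) ≈ f′ ∘ (g′ ∘ h)
  extendˡ p = ≈-trans (pullˡ p) assoc

  cancelˡ : f ∘ g ≈ id → f ∘ (g ∘ h) ≈ h
  cancelˡ p = ≈-trans (pullˡ p) identityˡ

  cancelʳ : f ∘ g ≈ id → (h ∘ f) ∘ g ≈ h
  cancelʳ p = ≈-trans assoc (≈-trans (refl⟩∘⟨ p) identityʳ)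

  iso-monic : f⁻¹ ∘ f ≈ id → f ∘ g ≈ f ∘ h → g ≈ h
  iso-monic i p = ≈-trans (≈-sym (cancelˡ i)) (≈-trans (refl⟩∘⟨ p) (cancelˡ i))

  iso-epic : f ∘ f⁻¹ ≈ id → g ∘ f ≈ h ∘ f → g ≈ h
  iso-epic i p = ≈-trans (≈-sym (cancelʳ i)) (≈-trans (p ⟩∘⟨refl) (cancelʳ i))

  -- Inverts two opposite sides of a commuting square. All naturality facts about `λ⇐`, `ρ⇐` and
  -- `α⇐` come from those of the forward maps in this way.
  square⁻¹ : f ∘ f⁻¹ ≈ id → g⁻¹ ∘ g ≈ id → k ∘ f ≈ g ∘ h → h ∘ f⁻¹ ≈ g⁻¹ ∘ k
  square⁻¹ {f = f} {f⁻¹ = f⁻¹} {g⁻¹ = g⁻¹} {g = g} {k = k} {h = h} i j p = begin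
    h ∘ f⁻¹                ≈⟨ cancelˡ j ⟨
    g⁻¹ ∘ (g ∘ (h ∘ f⁻¹))  ≈⟨ refl⟩∘⟨ extendˡ (≈-sym p) ⟩
    g⁻¹ ∘ (k ∘ (f ∘ f⁻¹))  ≈⟨ refl⟩∘⟨ refl⟩∘⟨ i ⟩
    g⁻¹ ∘ (k ∘ id)         ≈⟨ refl⟩∘⟨ identityʳ ⟩
    g⁻¹ ∘ k                ∎

  ⊗-inverse : f⁻¹ ∘ f ≈ id → g⁻¹ ∘ g ≈ id → (f⁻¹ ⊗₁ g⁻¹) ∘ (f ⊗₁ g) ≈ id
  ⊗-inverse p q = ≈-trans (≈-sym ⊗-∘) (≈-trans (p ⇉ q) ⊗-id)

  id⊗-∘ : (id {D} ⊗₁ f) ∘ (id ⊗₁ g) ≈ id ⊗₁ (f ∘ g)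
  id⊗-∘ = ≈-trans (≈-sym ⊗-∘) (identityˡ ⇉ ≈-refl)

  ⊗id-∘ : (f ⊗₁ id {D}) ∘ (g ⊗₁ id) ≈ (f ∘ g) ⊗₁ id
  ⊗id-∘ = ≈-trans (≈-sym ⊗-∘) (≈-refl ⇉ identityˡ)

  ⊗-first : (f ⊗₁ id) ∘ (id ⊗₁ g) ≈ f ⊗₁ g
  ⊗-first = ≈-trans (≈-sym ⊗-∘) (identityʳ ⇉ identityˡ)

  ⊗-second : (id ⊗₁ g) ∘ (f ⊗₁ id) ≈ f ⊗₁ g
  ⊗-second = ≈-trans (≈-sym ⊗-∘) (identityˡ ⇉ identityʳ)

  interchange : (f ⊗₁ id) ∘ (id ⊗₁ g) ≈ (id ⊗₁ g) ∘ (f ⊗₁ id)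
  interchange = ≈-trans ⊗-first (≈-sym ⊗-second)

  -- Since `λ⇒` is a natural isomorphism to the identity functor, tensoring with `I` is faithful.
  -- This permits proving equations about units in a larger diagram where the axioms apply.
  id⊗-injective : id {I} ⊗₁ f ≈ id ⊗₁ g → f ≈ g
  id⊗-injective p =
    iso-epic λ-isoʳ (≈-trans (≈-sym λ-natural) (≈-trans (refl⟩∘⟨ p) λ-natural))

  ⊗id-injective : f ⊗₁ id {I} ≈ g ⊗₁ id → f ≈ g
  ⊗id-injective p =
    iso-epic ρ-isoʳ (≈-trans (≈-sym ρ-natural) (≈-trans (refl⟩∘⟨ p) ρ-natural))

  α-natural₁ : α⇒ ∘ ((f ⊗₁ id) ⊗₁ id) ≈ (f ⊗₁ id {A ⊗₀ B}) ∘ α⇒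
  α-natural₁ = ≈-trans α-natural ((≈-refl ⇉ ⊗-id) ⟩∘⟨refl)

  α-natural₃ : α⇒ ∘ (id {A ⊗₀ B} ⊗₁ f) ≈ (id ⊗₁ (id ⊗₁ f)) ∘ α⇒
  α-natural₃ = ≈-trans (refl⟩∘⟨ (≈-sym ⊗-id ⇉ ≈-refl)) α-natural

  -- Kelly's argument: tensoring with `I` is faithful and the two associators precomposed here are
  -- invertible; after both steps the pentagon and the triangle apply.
  λ-α : λ⇒ {A ⊗₀ B} ∘ α⇒ ≈ λ⇒ ⊗₁ id
  λ-α = id⊗-injective (iso-epic (≈-trans assoc (≈-trans
      (refl⟩∘⟨ cancelˡ (⊗-inverse α-isoʳ identityˡ)) α-isoʳ)) (begin
    (id ⊗₁ (λ⇒ ∘ α⇒)) ∘ (α⇒ ∘ (α⇒ ⊗₁ id))          ≈⟨ pushˡ (≈-sym id⊗-∘) ⟩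
    (id ⊗₁ λ⇒) ∘ ((id ⊗₁ α⇒) ∘ (α⇒ ∘ (α⇒ ⊗₁ id)))  ≈⟨ refl⟩∘⟨ pentagon ⟩
    (id ⊗₁ λ⇒) ∘ (α⇒ ∘ α⇒)                          ≈⟨ pullˡ triangle ⟩
    (ρ⇒ ⊗₁ id) ∘ α⇒                                 ≈⟨ α-natural₁ ⟨
    α⇒ ∘ ((ρ⇒ ⊗₁ id) ⊗₁ id)                         ≈⟨ refl⟩∘⟨ (triangle ⇉ ≈-refl) ⟨
    α⇒ ∘ (((id ⊗₁ λ⇒) ∘ α⇒) ⊗₁ id)                  ≈⟨ refl⟩∘⟨ ⊗id-∘ ⟨
    α⇒ ∘ (((id ⊗₁ λ⇒) ⊗₁ id) ∘ (α⇒ ⊗₁ id))          ≈⟨ extendˡ α-natural ⟩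
    (id ⊗₁ (λ⇒ ⊗₁ id)) ∘ (α⇒ ∘ (α⇒ ⊗₁ id))          ∎))

  ρ-α : (id ⊗₁ ρ⇒) ∘ α⇒ ≈ ρ⇒ {A ⊗₀ B}
  ρ-α = ⊗id-injective (iso-monic α-isoˡ (begin
    α⇒ ∘ (((id ⊗₁ ρ⇒) ∘ α⇒) ⊗₁ id)                         ≈⟨ refl⟩∘⟨ ⊗id-∘ ⟨
    α⇒ ∘ (((id ⊗₁ ρ⇒) ⊗₁ id) ∘ (α⇒ ⊗₁ id))                 ≈⟨ extendˡ α-natural ⟩
    (id ⊗₁ (ρ⇒ ⊗₁ id)) ∘ (α⇒ ∘ (α⇒ ⊗₁ id))                 ≈⟨ (≈-refl ⇉ triangle) ⟩∘⟨refl ⟨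
    (id ⊗₁ ((id ⊗₁ λ⇒) ∘ α⇒)) ∘ (α⇒ ∘ (α⇒ ⊗₁ id))          ≈⟨ pushˡ (≈-sym id⊗-∘) ⟩
    (id ⊗₁ (id ⊗₁ λ⇒)) ∘ ((id ⊗₁ α⇒) ∘ (α⇒ ∘ (α⇒ ⊗₁ id)))  ≈⟨ refl⟩∘⟨ pentagon ⟩
    (id ⊗₁ (id ⊗₁ λ⇒)) ∘ (α⇒ ∘ α⇒)                          ≈⟨ extendˡ α-natural₃ ⟨
    α⇒ ∘ ((id ⊗₁ λ⇒) ∘ α⇒)                                  ≈⟨ refl⟩∘⟨ triangle ⟩
    α⇒ ∘ (ρ⇒ ⊗₁ id)                                         ∎))

  -- Naturality of `λ⇒` at itself identifies `λ⇒` on `I ⊗₀ I` with `id ⊗₁ λ⇒`, after which `λ-α` and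
  -- the triangle describe the same map.
  λ-ρ : λ⇒ {I} ≈ ρ⇒
  λ-ρ = ⊗id-injective (begin
    λ⇒ ⊗₁ id          ≈⟨ λ-α ⟨
    λ⇒ ∘ α⇒           ≈⟨ iso-monic λ-isoˡ (≈-sym λ-natural) ⟩∘⟨refl ⟩
    (id ⊗₁ λ⇒) ∘ α⇒   ≈⟨ triangle ⟩
    ρ⇒ ⊗₁ id          ∎)

  -- The hexagon with two of its objects equal to `I`, read after tensoring with `I`, yields this
  -- unit law for the symmetry.
  λ-γ : λ⇒ {A} ∘ γ ≈ ρ⇒
  λ-γ = ⊗id-injective (iso-monic symmetry (begin
    γ ∘ ((λ⇒ ∘ γ) ⊗₁ id)                    ≈⟨ refl⟩∘⟨ ⊗id-∘ ⟨
    γ ∘ ((λ⇒ ⊗₁ id) ∘ (γ ⊗₁ id))            ≈⟨ refl⟩∘⟨ λ-α ⟩∘⟨refl ⟨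
    γ ∘ ((λ⇒ ∘ α⇒) ∘ (γ ⊗₁ id))             ≈⟨ refl⟩∘⟨ assoc ⟩
    γ ∘ (λ⇒ ∘ (α⇒ ∘ (γ ⊗₁ id)))             ≈⟨ extendˡ λ-natural ⟨
    λ⇒ ∘ ((id ⊗₁ γ) ∘ (α⇒ ∘ (γ ⊗₁ id)))     ≈⟨ refl⟩∘⟨ hexagon ⟩
    λ⇒ ∘ (α⇒ ∘ (γ ∘ α⇒))                    ≈⟨ pullˡ λ-α ⟩
    (λ⇒ ⊗₁ id) ∘ (γ ∘ α⇒)                   ≈⟨ extendˡ γ-natural ⟨
    γ ∘ ((id ⊗₁ λ⇒) ∘ α⇒)                   ≈⟨ refl⟩∘⟨ triangle ⟩
    γ ∘ (ρ⇒ ⊗₁ id)                          ∎))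

  ρ-γ : ρ⇒ {A} ∘ γ ≈ λ⇒
  ρ-γ = ≈-trans (≈-sym λ-γ ⟩∘⟨refl) (cancelʳ symmetry)

  -- Written exactly like `exchange []`, so that it interprets Swap without conversion; it also
  -- carries a pulled variable past a left factor.
  σ⇒ : A ⊗₀ (B ⊗₀ D) ⇒ B ⊗₀ (A ⊗₀ D)
  σ⇒ = α⇒ ∘ ((γ ⊗₁ id) ∘ α⇐)

  σ-α : σ⇒ {A} {B} {D} ∘ α⇒ ≈ α⇒ ∘ (γ ⊗₁ id)
  σ-α = ≈-trans assoc (refl⟩∘⟨ cancelʳ α-isoˡ)

  σ-involutive : σ⇒ {B} {A} {D} ∘ σ⇒ ≈ id
  σ-involutive = iso-epic α-isoʳ (begin
    (σ⇒ ∘ σ⇒) ∘ α⇒                     ≈⟨ assoc ⟩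
    σ⇒ ∘ (σ⇒ ∘ α⇒)                     ≈⟨ refl⟩∘⟨ σ-α ⟩
    σ⇒ ∘ (α⇒ ∘ (γ ⊗₁ id))              ≈⟨ extendˡ σ-α ⟩
    α⇒ ∘ ((γ ⊗₁ id) ∘ (γ ⊗₁ id))       ≈⟨ refl⟩∘⟨ ⊗-inverse symmetry identityˡ ⟩
    α⇒ ∘ id                            ≈⟨ ≈-trans identityʳ (≈-sym identityˡ) ⟩
    id ∘ α⇒                            ∎)

  σ-natural : σ⇒ ∘ (f ⊗₁ (g ⊗₁ h)) ≈ (g ⊗₁ (f ⊗₁ h)) ∘ σ⇒
  σ-natural {f = f} {g = g} {h = h} = iso-epic α-isoʳ (begin
    (σ⇒ ∘ (f ⊗₁ (g ⊗₁ h))) ∘ α⇒        ≈⟨ assoc ⟩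
    σ⇒ ∘ ((f ⊗₁ (g ⊗₁ h)) ∘ α⇒)        ≈⟨ refl⟩∘⟨ α-natural ⟨
    σ⇒ ∘ (α⇒ ∘ ((f ⊗₁ g) ⊗₁ h))        ≈⟨ extendˡ σ-α ⟩
    α⇒ ∘ ((γ ⊗₁ id) ∘ ((f ⊗₁ g) ⊗₁ h))
      ≈⟨ refl⟩∘⟨ ≈-trans (≈-sym ⊗-∘) (≈-trans (γ-natural ⇉ ≈-trans identityˡ (≈-sym identityʳ)) ⊗-∘) ⟩
    α⇒ ∘ (((g ⊗₁ f) ⊗₁ h) ∘ (γ ⊗₁ id)) ≈⟨ extendˡ α-natural ⟩
    (g ⊗₁ (f ⊗₁ h)) ∘ (α⇒ ∘ (γ ⊗₁ id)) ≈⟨ refl⟩∘⟨ σ-α ⟨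
    (g ⊗₁ (f ⊗₁ h)) ∘ (σ⇒ ∘ α⇒)        ≈⟨ assoc ⟨
    ((g ⊗₁ (f ⊗₁ h)) ∘ σ⇒) ∘ α⇒        ∎)

  λ-σ : (id ⊗₁ λ⇒) ∘ σ⇒ ≈ λ⇒ {A ⊗₀ B}
  λ-σ = iso-epic α-isoʳ (begin
    ((id ⊗₁ λ⇒) ∘ σ⇒) ∘ α⇒            ≈⟨ assoc ⟩
    (id ⊗₁ λ⇒) ∘ (σ⇒ ∘ α⇒)            ≈⟨ refl⟩∘⟨ σ-α ⟩
    (id ⊗₁ λ⇒) ∘ (α⇒ ∘ (γ ⊗₁ id))     ≈⟨ pullˡ triangle ⟩
    (ρ⇒ ⊗₁ id) ∘ (γ ⊗₁ id)            ≈⟨ ≈-trans ⊗id-∘ (ρ-γ ⇉ ≈-refl) ⟩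
    λ⇒ ⊗₁ id                          ≈⟨ λ-α ⟨
    λ⇒ ∘ α⇒                           ∎)

  σ-α₂ : σ⇒ {A} {B} {D ⊗₀ E} ∘ ((id ⊗₁ α⇒) ∘ α⇒) ≈ (id ⊗₁ α⇒) ∘ (α⇒ ∘ (σ⇒ ⊗₁ id))
  σ-α₂ = iso-epic (⊗-inverse α-isoʳ identityˡ) (begin
    (σ⇒ ∘ ((id ⊗₁ α⇒) ∘ α⇒)) ∘ (α⇒ ⊗₁ id)             ≈⟨ ≈-trans assoc (refl⟩∘⟨ assoc) ⟩
    σ⇒ ∘ ((id ⊗₁ α⇒) ∘ (α⇒ ∘ (α⇒ ⊗₁ id)))             ≈⟨ refl⟩∘⟨ pentagon ⟩
    σ⇒ ∘ (α⇒ ∘ α⇒)                                     ≈⟨ extendˡ σ-α ⟩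
    α⇒ ∘ ((γ ⊗₁ id) ∘ α⇒)                              ≈⟨ refl⟩∘⟨ α-natural₁ ⟨
    α⇒ ∘ (α⇒ ∘ ((γ ⊗₁ id) ⊗₁ id))                      ≈⟨ pullˡ (≈-sym pentagon) ⟩
    ((id ⊗₁ α⇒) ∘ (α⇒ ∘ (α⇒ ⊗₁ id))) ∘ ((γ ⊗₁ id) ⊗₁ id) ≈⟨ ≈-trans assoc (refl⟩∘⟨ assoc) ⟩
    (id ⊗₁ α⇒) ∘ (α⇒ ∘ ((α⇒ ⊗₁ id) ∘ ((γ ⊗₁ id) ⊗₁ id)))
      ≈⟨ refl⟩∘⟨ refl⟩∘⟨ ≈-trans ⊗id-∘ (≈-sym σ-α ⇉ ≈-refl) ⟩
    (id ⊗₁ α⇒) ∘ (α⇒ ∘ ((σ⇒ ∘ α⇒) ⊗₁ id))              ≈⟨ refl⟩∘⟨ refl⟩∘⟨ ⊗id-∘ ⟨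
    (id ⊗₁ α⇒) ∘ (α⇒ ∘ ((σ⇒ ⊗₁ id) ∘ (α⇒ ⊗₁ id)))      ≈⟨ ≈-trans assoc (refl⟩∘⟨ assoc) ⟨
    ((id ⊗₁ α⇒) ∘ (α⇒ ∘ (σ⇒ ⊗₁ id))) ∘ (α⇒ ⊗₁ id)      ∎)

  -- The hexagon with one braiding cancelled by symmetry: a factor passes a product by passing its
  -- two parts in turn.
  σ-γ : σ⇒ ∘ ((id ⊗₁ γ) ∘ α⇒) ≈ γ {A ⊗₀ B} {D}
  σ-γ = iso-epic symmetry (iso-epic α-isoʳ (begin
    ((σ⇒ ∘ ((id ⊗₁ γ) ∘ α⇒)) ∘ γ) ∘ α⇒     ≈⟨ ≈-trans assoc (≈-trans assoc (refl⟩∘⟨ assoc)) ⟩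
    σ⇒ ∘ ((id ⊗₁ γ) ∘ (α⇒ ∘ (γ ∘ α⇒)))     ≈⟨ refl⟩∘⟨ refl⟩∘⟨ hexagon ⟨
    σ⇒ ∘ ((id ⊗₁ γ) ∘ ((id ⊗₁ γ) ∘ (α⇒ ∘ (γ ⊗₁ id))))
      ≈⟨ refl⟩∘⟨ cancelˡ (⊗-inverse identityˡ symmetry) ⟩
    σ⇒ ∘ (α⇒ ∘ (γ ⊗₁ id))                  ≈⟨ extendˡ σ-α ⟩
    α⇒ ∘ ((γ ⊗₁ id) ∘ (γ ⊗₁ id))           ≈⟨ refl⟩∘⟨ ⊗-inverse symmetry identityˡ ⟩
    α⇒ ∘ id                                ≈⟨ ≈-trans identityʳ (≈-sym identityˡ) ⟩
    id ∘ α⇒                                ≈⟨ symmetry ⟩∘⟨refl ⟨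
    (γ ∘ γ) ∘ α⇒                           ∎))

  -- This is `σ-γ` with a spectator factor; the pentagon and `σ-α₂` only move brackets. It serves
  -- for pulling a variable out of the last factor of `αₛ`.
  σ-α₃ : σ⇒ {A} {B} {D ⊗₀ E} ∘ ((id ⊗₁ σ⇒) ∘ α⇒) ≈ (id ⊗₁ α⇒) ∘ σ⇒
  σ-α₃ = iso-epic α-isoʳ (begin
    (σ⇒ ∘ ((id ⊗₁ σ⇒) ∘ α⇒)) ∘ α⇒                      ≈⟨ ≈-trans assoc (refl⟩∘⟨ assoc) ⟩
    σ⇒ ∘ ((id ⊗₁ σ⇒) ∘ (α⇒ ∘ α⇒))                      ≈⟨ refl⟩∘⟨ refl⟩∘⟨ pentagon ⟨
    σ⇒ ∘ ((id ⊗₁ σ⇒) ∘ ((id ⊗₁ α⇒) ∘ (α⇒ ∘ (α⇒ ⊗₁ id))))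
      ≈⟨ refl⟩∘⟨ pullˡ (≈-trans id⊗-∘ (≈-trans (≈-refl ⇉ σ-α) (≈-sym id⊗-∘))) ⟩
    σ⇒ ∘ (((id ⊗₁ α⇒) ∘ (id ⊗₁ (γ ⊗₁ id))) ∘ (α⇒ ∘ (α⇒ ⊗₁ id))) ≈⟨ refl⟩∘⟨ assoc ⟩
    σ⇒ ∘ ((id ⊗₁ α⇒) ∘ ((id ⊗₁ (γ ⊗₁ id)) ∘ (α⇒ ∘ (α⇒ ⊗₁ id)))) ≈⟨ refl⟩∘⟨ refl⟩∘⟨ extendˡ α-natural ⟨
    σ⇒ ∘ ((id ⊗₁ α⇒) ∘ (α⇒ ∘ (((id ⊗₁ γ) ⊗₁ id) ∘ (α⇒ ⊗₁ id))))
      ≈⟨ ≈-trans (≈-sym (≈-trans assoc (refl⟩∘⟨ assoc))) (σ-α₂ ⟩∘⟨refl) ⟩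
    ((id ⊗₁ α⇒) ∘ (α⇒ ∘ (σ⇒ ⊗₁ id))) ∘ (((id ⊗₁ γ) ⊗₁ id) ∘ (α⇒ ⊗₁ id))
      ≈⟨ ≈-trans assoc (refl⟩∘⟨ assoc) ⟩
    (id ⊗₁ α⇒) ∘ (α⇒ ∘ ((σ⇒ ⊗₁ id) ∘ (((id ⊗₁ γ) ⊗₁ id) ∘ (α⇒ ⊗₁ id))))
      ≈⟨ refl⟩∘⟨ refl⟩∘⟨ ≈-trans (refl⟩∘⟨ ⊗id-∘) (≈-trans ⊗id-∘ (σ-γ ⇉ ≈-refl)) ⟩
    (id ⊗₁ α⇒) ∘ (α⇒ ∘ (γ ⊗₁ id))                      ≈⟨ refl⟩∘⟨ σ-α ⟨
    (id ⊗₁ α⇒) ∘ (σ⇒ ∘ α⇒)                             ≈⟨ assoc ⟨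
    ((id ⊗₁ α⇒) ∘ σ⇒) ∘ α⇒                             ∎)

  σ-γ₁ : σ⇒ ∘ γ {A ⊗₀ B} {D} ≈ (id ⊗₁ γ) ∘ α⇒
  σ-γ₁ = ≈-trans (refl⟩∘⟨ ≈-sym σ-γ) (cancelˡ σ-involutive)

  α-γ₂ : α⇒ ∘ γ {D} {A ⊗₀ B} ≈ (id ⊗₁ γ) ∘ σ⇒
  α-γ₂ = iso-epic α-isoʳ (begin
    (α⇒ ∘ γ) ∘ α⇒                  ≈⟨ assoc ⟩
    α⇒ ∘ (γ ∘ α⇒)                  ≈⟨ hexagon ⟨
    (id ⊗₁ γ) ∘ (α⇒ ∘ (γ ⊗₁ id))   ≈⟨ refl⟩∘⟨ σ-α ⟨
    (id ⊗₁ γ) ∘ (σ⇒ ∘ α⇒)          ≈⟨ assoc ⟨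
    ((id ⊗₁ γ) ∘ σ⇒) ∘ α⇒          ∎)

-- Structural maps and their coherence

module Trees (K V : Set) where

  infixr 7 _⊙_
  -- Bracketing and units are retained, so that splitting a context is itself a structural map and
  -- not an operation on lists.
  data Tree : Set where
    unit : Tree
    leaf : K → V → Tree
    _⊙_  : Tree → Tree → Tree

  private variable
    x y : K
    A B : V
    S T U S′ T′ : Tree

  infix 4 _∶_∈_ _⊆_ _∈ₙ_
  data _∶_∈_ (x : K) (A : V) : Tree → Set where
    here  : x ∶ A ∈ leaf x A
    left  : x ∶ A ∈ S → x ∶ A ∈ S ⊙ T
    right : x ∶ A ∈ T → x ∶ A ∈ S ⊙ T

  _∈ₙ_ : K → Tree → Set
  x ∈ₙ T = ∃ λ A → x ∶ A ∈ T

  _⊆_ : Tree → Tree → Set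
  S ⊆ T = ∀ {x A} → x ∶ A ∈ S → x ∶ A ∈ T

  Empty : Tree → Set
  Empty T = ∀ {x A} → x ∶ A ∈ T → ⊥

  -- Names are compared regardless of types, so a linear tree cannot hold one name at two types.
  Disjoint : Tree → Tree → Set
  Disjoint S T = ∀ {x A B} → x ∶ A ∈ S → x ∶ B ∈ T → ⊥

  Linear : Tree → Set
  Linear unit       = ⊤
  Linear (leaf _ _) = ⊤
  Linear (S ⊙ T)    = Linear S × Linear T × Disjoint S T

  empty? : ∀ T → Empty T ⊎ (∃ λ x → x ∈ₙ T)
  empty? unit       = inj₁ λ ()
  empty? (leaf x A) = inj₂ (x , A , here)
  empty? (S ⊙ T) with empty? S | empty? T
  ... | inj₂ (x , A , i) | _                = inj₂ (x , A , left i)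
  ... | inj₁ _           | inj₂ (x , A , i) = inj₂ (x , A , right i)
  ... | inj₁ p           | inj₁ q           = inj₁ λ { (left i) → p i ; (right i) → q i }

  ∈-unique : Linear T → (i j : x ∶ A ∈ T) → i ≡ j
  ∈-unique d           here      here      = refl
  ∈-unique (d , _ , _) (left i)  (left j)  = cong left (∈-unique d i j)
  ∈-unique (_ , _ , p) (left i)  (right j) = ⊥-elim (p i j)
  ∈-unique (_ , _ , p) (right i) (left j)  = ⊥-elim (p j i)
  ∈-unique (_ , d , _) (right i) (right j) = cong right (∈-unique d i j)

  type-unique : Linear T → x ∶ A ∈ T → x ∶ B ∈ T → A ≡ B
  type-unique d           here      here      = refl
  type-unique (d , _ , _) (left i)  (left j)  = type-unique d i j
  type-unique (_ , _ , p) (left i)  (right j) = ⊥-elim (p i j)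
  type-unique (_ , _ , p) (right i) (left j)  = ⊥-elim (p j i)
  type-unique (_ , d , _) (right i) (right j) = type-unique d i j

  infixl 8 _∖_
  -- The removed leaf becomes `unit` and the shape is kept. Hence each generator of `_⟿_` restricts
  -- to the same generator on the remaining variables, which is all that `residual` has to say.
  _∖_ : ∀ T → x ∶ A ∈ T → Tree
  leaf _ _ ∖ here    = unit
  (S ⊙ T)  ∖ left i  = (S ∖ i) ⊙ T
  (S ⊙ T)  ∖ right i = S ⊙ (T ∖ i)

  -- Counts leaves only, because removal keeps the shape; it measures the recursions that remove a
  -- variable, where the smaller tree is not a subterm.
  size : Tree → ℕ
  size unit       = 0
  size (leaf _ _) = 1
  size (S ⊙ T)    = size S + size T

  size-∖ : (i : x ∶ A ∈ T) → size T ≡ suc (size (T ∖ i))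
  size-∖ here      = refl
  size-∖ (left i)  = cong (_+ _) (size-∖ i)
  size-∖ (right {S = S} i) = trans (cong (size S +_) (size-∖ i)) (+-suc (size S) _)

  ∖-⊆ : (i : x ∶ A ∈ T) → T ∖ i ⊆ T
  ∖-⊆ (left i)  (left j)  = left (∖-⊆ i j)
  ∖-⊆ (left i)  (right j) = right j
  ∖-⊆ (right i) (left j)  = left j
  ∖-⊆ (right i) (right j) = right (∖-⊆ i j)

  ∖-linear : (i : x ∶ A ∈ T) → Linear T → Linear (T ∖ i)
  ∖-linear here      d           = tt
  ∖-linear (left i)  (d , e , p) = ∖-linear i d , e , λ j → p (∖-⊆ i j)
  ∖-linear (right i) (d , e , p) = d , ∖-linear i e , λ j k → p j (∖-⊆ i k)

  removed : Linear T → (i : x ∶ A ∈ T) → x ∶ B ∈ T ∖ i → ⊥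
  removed (d , _ , _) (left i)  (left j)  = removed d i j
  removed (_ , _ , p) (left i)  (right j) = p i j
  removed (_ , _ , p) (right i) (left j)  = p j i
  removed (_ , e , _) (right i) (right j) = removed e i j

  kept : (i : x ∶ A ∈ T) → x ≢ y → y ∶ B ∈ T → y ∶ B ∈ T ∖ i
  kept here      n here      = ⊥-elim (n refl)
  kept (left i)  n (left j)  = left (kept i n j)
  kept (left i)  n (right j) = right j
  kept (right i) n (left j)  = left j
  kept (right i) n (right j) = right (kept i n j)

  infix  4 _⟿_
  infixr 9 _∘ₛ_
  infixr 10 _⊗ₛ_
  data _⟿_ : Tree → Tree → Set where
    idₛ  : T ⟿ T
    _∘ₛ_ : T ⟿ U → S ⟿ T → S ⟿ U
    _⊗ₛ_ : S ⟿ S′ → T ⟿ T′ → S ⊙ T ⟿ S′ ⊙ T′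
    λₛ   : unit ⊙ T ⟿ T
    λₛ⁻¹ : T ⟿ unit ⊙ T
    ρₛ   : T ⊙ unit ⟿ T
    ρₛ⁻¹ : T ⟿ T ⊙ unit
    αₛ   : (S ⊙ T) ⊙ U ⟿ S ⊙ (T ⊙ U)
    αₛ⁻¹ : S ⊙ (T ⊙ U) ⟿ (S ⊙ T) ⊙ U
    γₛ   : S ⊙ T ⟿ T ⊙ S

  infix 11 _⁻¹
  _⁻¹ : S ⟿ T → T ⟿ S
  idₛ ⁻¹      = idₛ
  (φ ∘ₛ ψ) ⁻¹ = ψ ⁻¹ ∘ₛ φ ⁻¹
  (φ ⊗ₛ ψ) ⁻¹ = φ ⁻¹ ⊗ₛ ψ ⁻¹
  λₛ ⁻¹       = λₛ⁻¹
  λₛ⁻¹ ⁻¹     = λₛ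
  ρₛ ⁻¹       = ρₛ⁻¹
  ρₛ⁻¹ ⁻¹     = ρₛ
  αₛ ⁻¹       = αₛ⁻¹
  αₛ⁻¹ ⁻¹     = αₛ
  γₛ ⁻¹       = γₛ

  σₛ : S ⊙ (T ⊙ U) ⟿ T ⊙ (S ⊙ U)
  σₛ = αₛ ∘ₛ ((γₛ ⊗ₛ idₛ) ∘ₛ αₛ⁻¹)

  pull : (i : x ∶ A ∈ T) → T ⟿ leaf x A ⊙ (T ∖ i)
  pull here      = ρₛ⁻¹
  pull (left i)  = αₛ ∘ₛ (pull i ⊗ₛ idₛ)
  pull (right i) = σₛ ∘ₛ (idₛ ⊗ₛ pull i)

  move : S ⟿ T → S ⊆ T
  move idₛ      i                 = i
  move (φ ∘ₛ ψ) i                 = move φ (move ψ i)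
  move (φ ⊗ₛ ψ) (left i)          = left (move φ i)
  move (φ ⊗ₛ ψ) (right i)         = right (move ψ i)
  move λₛ       (right i)         = i
  move λₛ⁻¹     i                 = right i
  move ρₛ       (left i)          = i
  move ρₛ⁻¹     i                 = left i
  move αₛ       (left (left i))   = left i
  move αₛ       (left (right i))  = right (left i)
  move αₛ       (right i)         = right (right i)
  move αₛ⁻¹     (left i)          = left (left i)
  move αₛ⁻¹     (right (left i))  = left (right i)
  move αₛ⁻¹     (right (right i)) = right i
  move γₛ       (left i)          = right i
  move γₛ       (right i)         = left i

  residual : (φ : S ⟿ T) (i : x ∶ A ∈ S) → S ∖ i ⟿ T ∖ move φ i
  residual idₛ      i                 = idₛ
  residual (φ ∘ₛ ψ) i                 = residual φ (move ψ i) ∘ₛ residual ψ i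
  residual (φ ⊗ₛ ψ) (left i)          = residual φ i ⊗ₛ ψ
  residual (φ ⊗ₛ ψ) (right i)         = φ ⊗ₛ residual ψ i
  residual λₛ       (right i)         = λₛ
  residual λₛ⁻¹     i                 = λₛ⁻¹
  residual ρₛ       (left i)          = ρₛ
  residual ρₛ⁻¹     i                 = ρₛ⁻¹
  residual αₛ       (left (left i))   = αₛ
  residual αₛ       (left (right i))  = αₛ
  residual αₛ       (right i)         = αₛ
  residual αₛ⁻¹     (left i)          = αₛ⁻¹
  residual αₛ⁻¹     (right (left i))  = αₛ⁻¹
  residual αₛ⁻¹     (right (right i)) = αₛ⁻¹
  residual γₛ       (left i)          = γₛ
  residual γₛ       (right i)         = γₛ

  move-linear : S ⟿ T → Linear S → Linear T
  move-linear idₛ      d           = d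
  move-linear (φ ∘ₛ ψ) d           = move-linear φ (move-linear ψ d)
  move-linear (φ ⊗ₛ ψ) (d , e , p) =
    move-linear φ d , move-linear ψ e , λ i j → p (move (φ ⁻¹) i) (move (ψ ⁻¹) j)
  move-linear λₛ (_ , d , _) = d
  move-linear λₛ⁻¹ d           = tt , d , λ ()
  move-linear ρₛ (d , _ , _) = d
  move-linear ρₛ⁻¹ d           = d , tt , λ _ ()
  move-linear αₛ ((d , e , p) , f , q) =
    d , (e , f , λ i → q (right i)) , λ { i (left j) → p i j ; i (right j) → q (left i) j }
  move-linear αₛ⁻¹ (d , (e , f , p) , q) =
    (d , e , λ i j → q i (left j)) , f , λ { (left i) j → q i (right j) ; (right i) j → p i j }
  move-linear γₛ  (d , e , p) = e , d , λ i j → p j i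

  empty⟿unit : ∀ T → Empty T → T ⟿ unit
  empty⟿unit unit       e = idₛ
  empty⟿unit (leaf _ _) e = ⊥-elim (e here)
  empty⟿unit (S ⊙ T)    e =
    λₛ ∘ₛ (empty⟿unit S (λ i → e (left i)) ⊗ₛ empty⟿unit T (λ i → e (right i)))

  -- A variable of `S` and its copy in `T` are both pulled to the front. By linearity neither occurs
  -- again in what is left, so the remaining trees still have the same variables.
  structural : Linear S → Linear T → S ⊆ T → T ⊆ S → S ⟿ T
  structural {S} = go (size S) refl
    where
    go : ∀ {S T} n → size S ≡ n → Linear S → Linear T → S ⊆ T → T ⊆ S → S ⟿ T
    go {S} {T} n eq d e p q with empty? S
    ... | inj₁ none = empty⟿unit T (λ i → none (q i)) ⁻¹ ∘ₛ empty⟿unit S none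
    go {S} {T} zero eq d e p q | inj₂ (_ , _ , i) with () ← trans (sym (size-∖ i)) eq
    go {S} {T} (suc n) eq d e p q | inj₂ (_ , _ , i) =
      pull (p i) ⁻¹ ∘ₛ
      (idₛ ⊗ₛ go n (suc-injective (trans (sym (size-∖ i)) eq)) (∖-linear i d) (∖-linear (p i) e)
        (λ j → kept (p i) (λ { refl → removed d i j }) (p (∖-⊆ i j)))
        (λ j → kept i (λ { refl → removed e (p i) j }) (q (∖-⊆ (p i) j)))) ∘ₛ
      pull i

-- Uniqueness of interpreted structural maps

module Coherence {o ℓ e} (C : SymmetricMonoidalCategory o ℓ e) (K V : Set)
                 (ob : V → SymmetricMonoidalCategory.Obj C) where
  open SMC C
  open Trees K V

  private variable
    x : K
    A : V
    S T U : Tree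

  ⟦_⟧₀ : Tree → Obj
  ⟦ unit ⟧₀     = I
  ⟦ leaf _ A ⟧₀ = ob A
  ⟦ S ⊙ T ⟧₀    = ⟦ S ⟧₀ ⊗₀ ⟦ T ⟧₀

  ⟦_⟧₁ : S ⟿ T → ⟦ S ⟧₀ ⇒ ⟦ T ⟧₀
  ⟦ idₛ ⟧₁    = id
  ⟦ φ ∘ₛ ψ ⟧₁ = ⟦ φ ⟧₁ ∘ ⟦ ψ ⟧₁
  ⟦ φ ⊗ₛ ψ ⟧₁ = ⟦ φ ⟧₁ ⊗₁ ⟦ ψ ⟧₁
  ⟦ λₛ ⟧₁   = λ⇒
  ⟦ λₛ⁻¹ ⟧₁  = λ⇐
  ⟦ ρₛ ⟧₁   = ρ⇒
  ⟦ ρₛ⁻¹ ⟧₁   = ρ⇐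
  ⟦ αₛ ⟧₁   = α⇒
  ⟦ αₛ⁻¹ ⟧₁   = α⇐
  ⟦ γₛ ⟧₁    = γ

  ⁻¹-isoˡ : (φ : S ⟿ T) → ⟦ φ ⁻¹ ⟧₁ ∘ ⟦ φ ⟧₁ ≈ id
  ⁻¹-isoˡ idₛ      = identityˡ
  ⁻¹-isoˡ (φ ∘ₛ ψ) = ≈-trans assoc (≈-trans (refl⟩∘⟨ cancelˡ (⁻¹-isoˡ φ)) (⁻¹-isoˡ ψ))
  ⁻¹-isoˡ (φ ⊗ₛ ψ) = ⊗-inverse (⁻¹-isoˡ φ) (⁻¹-isoˡ ψ)
  ⁻¹-isoˡ λₛ     = λ-isoˡ
  ⁻¹-isoˡ λₛ⁻¹     = λ-isoʳ
  ⁻¹-isoˡ ρₛ     = ρ-isoˡ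
  ⁻¹-isoˡ ρₛ⁻¹     = ρ-isoʳ
  ⁻¹-isoˡ αₛ     = α-isoˡ
  ⁻¹-isoˡ αₛ⁻¹     = α-isoʳ
  ⁻¹-isoˡ γₛ      = symmetry

  open ≈-Reasoning

  pull-λ : (i : x ∶ A ∈ T) →
           ⟦ pull i ⟧₁ ∘ λ⇒ ≈ (id ⊗₁ λ⇒) ∘ ⟦ pull (right {S = unit} i) ⟧₁
  pull-λ i = begin
    ⟦ pull i ⟧₁ ∘ λ⇒                            ≈⟨ λ-natural ⟨
    λ⇒ ∘ (id ⊗₁ ⟦ pull i ⟧₁)                    ≈⟨ pushˡ (≈-sym λ-σ) ⟩
    (id ⊗₁ λ⇒) ∘ (σ⇒ ∘ (id ⊗₁ ⟦ pull i ⟧₁))     ∎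

  pull-ρ : (i : x ∶ A ∈ T) →
           ⟦ pull i ⟧₁ ∘ ρ⇒ ≈ (id ⊗₁ ρ⇒) ∘ ⟦ pull (left {T = unit} i) ⟧₁
  pull-ρ i = begin
    ⟦ pull i ⟧₁ ∘ ρ⇒                            ≈⟨ ρ-natural ⟨
    ρ⇒ ∘ (⟦ pull i ⟧₁ ⊗₁ id)                    ≈⟨ pushˡ (≈-sym ρ-α) ⟩
    (id ⊗₁ ρ⇒) ∘ (α⇒ ∘ (⟦ pull i ⟧₁ ⊗₁ id))     ∎

  pull-α : ∀ {S T U} (i : x ∶ A ∈ (S ⊙ T) ⊙ U) →
           ⟦ pull (move αₛ i) ⟧₁ ∘ α⇒ ≈ (id ⊗₁ ⟦ residual αₛ i ⟧₁) ∘ ⟦ pull i ⟧₁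
  pull-α (left (left i)) = begin
    (α⇒ ∘ (⟦ pull i ⟧₁ ⊗₁ id)) ∘ α⇒                          ≈⟨ assoc ⟩
    α⇒ ∘ ((⟦ pull i ⟧₁ ⊗₁ id) ∘ α⇒)                          ≈⟨ refl⟩∘⟨ α-natural₁ ⟨
    α⇒ ∘ (α⇒ ∘ ((⟦ pull i ⟧₁ ⊗₁ id) ⊗₁ id))                  ≈⟨ pullˡ (≈-sym pentagon) ⟩
    ((id ⊗₁ α⇒) ∘ (α⇒ ∘ (α⇒ ⊗₁ id))) ∘ ((⟦ pull i ⟧₁ ⊗₁ id) ⊗₁ id) ≈⟨ ≈-trans assoc (refl⟩∘⟨ assoc) ⟩
    (id ⊗₁ α⇒) ∘ (α⇒ ∘ ((α⇒ ⊗₁ id) ∘ ((⟦ pull i ⟧₁ ⊗₁ id) ⊗₁ id))) ≈⟨ refl⟩∘⟨ refl⟩∘⟨ ⊗id-∘ ⟩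
    (id ⊗₁ α⇒) ∘ (α⇒ ∘ ((α⇒ ∘ (⟦ pull i ⟧₁ ⊗₁ id)) ⊗₁ id))   ∎
  pull-α (left (right i)) = begin
    (σ⇒ ∘ (id ⊗₁ (α⇒ ∘ (⟦ pull i ⟧₁ ⊗₁ id)))) ∘ α⇒
      ≈⟨ ≈-trans assoc (refl⟩∘⟨ pushˡ (≈-sym id⊗-∘)) ⟩
    σ⇒ ∘ ((id ⊗₁ α⇒) ∘ ((id ⊗₁ (⟦ pull i ⟧₁ ⊗₁ id)) ∘ α⇒))   ≈⟨ refl⟩∘⟨ refl⟩∘⟨ α-natural ⟨
    σ⇒ ∘ ((id ⊗₁ α⇒) ∘ (α⇒ ∘ ((id ⊗₁ ⟦ pull i ⟧₁) ⊗₁ id)))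
      ≈⟨ ≈-trans (≈-sym (≈-trans assoc (refl⟩∘⟨ assoc))) (σ-α₂ ⟩∘⟨refl) ⟩
    ((id ⊗₁ α⇒) ∘ (α⇒ ∘ (σ⇒ ⊗₁ id))) ∘ ((id ⊗₁ ⟦ pull i ⟧₁) ⊗₁ id) ≈⟨ ≈-trans assoc (refl⟩∘⟨ assoc) ⟩
    (id ⊗₁ α⇒) ∘ (α⇒ ∘ ((σ⇒ ⊗₁ id) ∘ ((id ⊗₁ ⟦ pull i ⟧₁) ⊗₁ id))) ≈⟨ refl⟩∘⟨ refl⟩∘⟨ ⊗id-∘ ⟩
    (id ⊗₁ α⇒) ∘ (α⇒ ∘ ((σ⇒ ∘ (id ⊗₁ ⟦ pull i ⟧₁)) ⊗₁ id))   ∎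
  pull-α (right i) = begin
    (σ⇒ ∘ (id ⊗₁ (σ⇒ ∘ (id ⊗₁ ⟦ pull i ⟧₁)))) ∘ α⇒
      ≈⟨ ≈-trans assoc (refl⟩∘⟨ pushˡ (≈-sym id⊗-∘)) ⟩
    σ⇒ ∘ ((id ⊗₁ σ⇒) ∘ ((id ⊗₁ (id ⊗₁ ⟦ pull i ⟧₁)) ∘ α⇒))   ≈⟨ refl⟩∘⟨ refl⟩∘⟨ α-natural₃ ⟨
    σ⇒ ∘ ((id ⊗₁ σ⇒) ∘ (α⇒ ∘ (id ⊗₁ ⟦ pull i ⟧₁)))
      ≈⟨ ≈-trans (≈-sym (≈-trans assoc (refl⟩∘⟨ assoc))) (σ-α₃ ⟩∘⟨refl) ⟩
    ((id ⊗₁ α⇒) ∘ σ⇒) ∘ (id ⊗₁ ⟦ pull i ⟧₁)                  ≈⟨ assoc ⟩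
    (id ⊗₁ α⇒) ∘ (σ⇒ ∘ (id ⊗₁ ⟦ pull i ⟧₁))                  ∎

  -- Induction leaves one square for each generator and position of the variable; these are the
  -- identities for `σ⇒`, the unit laws and the pentagon. An inverse generator inherits the square
  -- of its forward version.
  pull-natural : (φ : S ⟿ T) (i : x ∶ A ∈ S) →
                 ⟦ pull (move φ i) ⟧₁ ∘ ⟦ φ ⟧₁ ≈ (id ⊗₁ ⟦ residual φ i ⟧₁) ∘ ⟦ pull i ⟧₁
  pull-natural idₛ i = ≈-trans identityʳ (≈-sym (≈-trans (⊗-id ⟩∘⟨refl) identityˡ))
  pull-natural (φ ∘ₛ ψ) i = begin
    ⟦ pull (move φ (move ψ i)) ⟧₁ ∘ (⟦ φ ⟧₁ ∘ ⟦ ψ ⟧₁)    ≈⟨ extendˡ (pull-natural φ (move ψ i)) ⟩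
    (id ⊗₁ ⟦ residual φ (move ψ i) ⟧₁) ∘ (⟦ pull (move ψ i) ⟧₁ ∘ ⟦ ψ ⟧₁) ≈⟨ refl⟩∘⟨ pull-natural ψ i ⟩
    (id ⊗₁ ⟦ residual φ (move ψ i) ⟧₁) ∘ ((id ⊗₁ ⟦ residual ψ i ⟧₁) ∘ ⟦ pull i ⟧₁) ≈⟨ pullˡ id⊗-∘ ⟩
    (id ⊗₁ (⟦ residual φ (move ψ i) ⟧₁ ∘ ⟦ residual ψ i ⟧₁)) ∘ ⟦ pull i ⟧₁ ∎
  pull-natural (φ ⊗ₛ ψ) (left i) = begin
    (α⇒ ∘ (⟦ pull (move φ i) ⟧₁ ⊗₁ id)) ∘ (⟦ φ ⟧₁ ⊗₁ ⟦ ψ ⟧₁)   ≈⟨ assoc ⟩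
    α⇒ ∘ ((⟦ pull (move φ i) ⟧₁ ⊗₁ id) ∘ (⟦ φ ⟧₁ ⊗₁ ⟦ ψ ⟧₁))
      ≈⟨ refl⟩∘⟨ ≈-trans (≈-sym ⊗-∘) (≈-trans (pull-natural φ i ⇉ ≈-trans identityˡ (≈-sym identityʳ)) ⊗-∘) ⟩
    α⇒ ∘ (((id ⊗₁ ⟦ residual φ i ⟧₁) ⊗₁ ⟦ ψ ⟧₁) ∘ (⟦ pull i ⟧₁ ⊗₁ id)) ≈⟨ extendˡ α-natural ⟩
    (id ⊗₁ (⟦ residual φ i ⟧₁ ⊗₁ ⟦ ψ ⟧₁)) ∘ (α⇒ ∘ (⟦ pull i ⟧₁ ⊗₁ id)) ∎
  pull-natural (φ ⊗ₛ ψ) (right i) = begin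
    (σ⇒ ∘ (id ⊗₁ ⟦ pull (move ψ i) ⟧₁)) ∘ (⟦ φ ⟧₁ ⊗₁ ⟦ ψ ⟧₁)   ≈⟨ assoc ⟩
    σ⇒ ∘ ((id ⊗₁ ⟦ pull (move ψ i) ⟧₁) ∘ (⟦ φ ⟧₁ ⊗₁ ⟦ ψ ⟧₁))
      ≈⟨ refl⟩∘⟨ ≈-trans (≈-sym ⊗-∘) (≈-trans (≈-trans identityˡ (≈-sym identityʳ) ⇉ pull-natural ψ i) ⊗-∘) ⟩
    σ⇒ ∘ ((⟦ φ ⟧₁ ⊗₁ (id ⊗₁ ⟦ residual ψ i ⟧₁)) ∘ (id ⊗₁ ⟦ pull i ⟧₁)) ≈⟨ extendˡ σ-natural ⟩
    (id ⊗₁ (⟦ φ ⟧₁ ⊗₁ ⟦ residual ψ i ⟧₁)) ∘ (σ⇒ ∘ (id ⊗₁ ⟦ pull i ⟧₁)) ∎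
  pull-natural λₛ (right i) = pull-λ i
  pull-natural λₛ⁻¹ i = square⁻¹ λ-isoʳ (⊗-inverse identityˡ λ-isoˡ) (pull-λ i)
  pull-natural ρₛ (left i) = pull-ρ i
  pull-natural ρₛ⁻¹ i = square⁻¹ ρ-isoʳ (⊗-inverse identityˡ ρ-isoˡ) (pull-ρ i)
  pull-natural αₛ i = pull-α i
  pull-natural (αₛ⁻¹ {S} {T} {U}) (left i) =
    square⁻¹ α-isoʳ (⊗-inverse identityˡ α-isoˡ) (pull-α {S = S} {T} {U} (left (left i)))
  pull-natural (αₛ⁻¹ {S} {T} {U}) (right (left i)) =
    square⁻¹ α-isoʳ (⊗-inverse identityˡ α-isoˡ) (pull-α {S = S} {T} {U} (left (right i)))
  pull-natural (αₛ⁻¹ {S} {T} {U}) (right (right i)) =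
    square⁻¹ α-isoʳ (⊗-inverse identityˡ α-isoˡ) (pull-α {S = S} {T} {U} (right i))
  pull-natural γₛ (left i) = begin
    (σ⇒ ∘ (id ⊗₁ ⟦ pull i ⟧₁)) ∘ γ             ≈⟨ assoc ⟩
    σ⇒ ∘ ((id ⊗₁ ⟦ pull i ⟧₁) ∘ γ)             ≈⟨ refl⟩∘⟨ γ-natural ⟨
    σ⇒ ∘ (γ ∘ (⟦ pull i ⟧₁ ⊗₁ id))             ≈⟨ extendˡ σ-γ₁ ⟩
    (id ⊗₁ γ) ∘ (α⇒ ∘ (⟦ pull i ⟧₁ ⊗₁ id))     ∎
  pull-natural γₛ (right i) = begin
    (α⇒ ∘ (⟦ pull i ⟧₁ ⊗₁ id)) ∘ γ             ≈⟨ assoc ⟩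
    α⇒ ∘ ((⟦ pull i ⟧₁ ⊗₁ id) ∘ γ)             ≈⟨ refl⟩∘⟨ γ-natural ⟨
    α⇒ ∘ (γ ∘ (id ⊗₁ ⟦ pull i ⟧₁))             ≈⟨ extendˡ α-γ₂ ⟩
    (id ⊗₁ γ) ∘ (σ⇒ ∘ (id ⊗₁ ⟦ pull i ⟧₁))     ∎

  ε : ∀ T → Empty T → ⟦ T ⟧₀ ⇒ I
  ε T e = ⟦ empty⟿unit T e ⟧₁

  -- Emptiness proofs are functions and may differ without being provably equal; the map to `I` is
  -- insensitive to that choice.
  ε-irrelevant : ∀ T (e e′ : Empty T) → ε T e ≈ ε T e′
  ε-irrelevant unit       e e′ = ≈-refl
  ε-irrelevant (leaf _ _) e e′ = ⊥-elim (e here)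
  ε-irrelevant (S ⊙ T)    e e′ =
    refl⟩∘⟨ (ε-irrelevant S (λ i → e (left i)) (λ i → e′ (left i)) ⇉
             ε-irrelevant T (λ i → e (right i)) (λ i → e′ (right i)))

  ε-λ : ∀ T (e : Empty T) (e′ : Empty (unit ⊙ T)) → ε T e ∘ λ⇒ ≈ ε (unit ⊙ T) e′
  ε-λ T e e′ = ≈-trans (≈-sym λ-natural) (refl⟩∘⟨ (≈-refl ⇉ ε-irrelevant T _ _))

  ε-ρ : ∀ T (e : Empty T) (e′ : Empty (T ⊙ unit)) → ε T e ∘ ρ⇒ ≈ ε (T ⊙ unit) e′
  ε-ρ T e e′ = ≈-trans (≈-sym ρ-natural) (≈-sym λ-ρ ⟩∘⟨ (ε-irrelevant T _ _ ⇉ ≈-refl))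

  ε-α : ∀ S T U (e : Empty (S ⊙ (T ⊙ U))) (e′ : Empty ((S ⊙ T) ⊙ U)) →
        ε (S ⊙ (T ⊙ U)) e ∘ α⇒ ≈ ε ((S ⊙ T) ⊙ U) e′
  ε-α S T U e e′ = begin
    (λ⇒ ∘ (s ⊗₁ (λ⇒ ∘ (t ⊗₁ u)))) ∘ α⇒
      ≈⟨ ≈-trans assoc (refl⟩∘⟨ pushˡ (≈-trans (≈-sym identityˡ ⇉ ≈-refl) ⊗-∘)) ⟩
    λ⇒ ∘ ((id ⊗₁ λ⇒) ∘ ((s ⊗₁ (t ⊗₁ u)) ∘ α⇒))         ≈⟨ refl⟩∘⟨ refl⟩∘⟨ α-natural ⟨
    λ⇒ ∘ ((id ⊗₁ λ⇒) ∘ (α⇒ ∘ ((s ⊗₁ t) ⊗₁ u)))         ≈⟨ refl⟩∘⟨ pullˡ triangle ⟩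
    λ⇒ ∘ ((ρ⇒ ⊗₁ id) ∘ ((s ⊗₁ t) ⊗₁ u))                ≈⟨ refl⟩∘⟨ ⊗-∘ ⟨
    λ⇒ ∘ ((ρ⇒ ∘ (s ⊗₁ t)) ⊗₁ (id ∘ u))
      ≈⟨ refl⟩∘⟨ ((≈-sym λ-ρ ⟩∘⟨ (ε-irrelevant S _ _ ⇉ ε-irrelevant T _ _)) ⇉ ≈-trans identityˡ (ε-irrelevant U _ _)) ⟩
    ε ((S ⊙ T) ⊙ U) e′                                 ∎
    where
    s = ε S (λ i → e (left i))
    t = ε T (λ i → e (right (left i)))
    u = ε U (λ i → e (right (right i)))

  ε-γ : ∀ S T (e : Empty (T ⊙ S)) (e′ : Empty (S ⊙ T)) → ε (T ⊙ S) e ∘ γ ≈ ε (S ⊙ T) e′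
  ε-γ S T e e′ = begin
    (λ⇒ ∘ (ε T _ ⊗₁ ε S _)) ∘ γ  ≈⟨ ≈-trans assoc (refl⟩∘⟨ ≈-sym γ-natural) ⟩
    λ⇒ ∘ (γ ∘ (ε S _ ⊗₁ ε T _))  ≈⟨ pullˡ (≈-trans λ-γ (≈-sym λ-ρ)) ⟩
    λ⇒ ∘ (ε S _ ⊗₁ ε T _)
      ≈⟨ ε-irrelevant (S ⊙ T) (λ { (left i) → e (right i) ; (right i) → e (left i) }) e′ ⟩
    ε (S ⊙ T) e′                 ∎

  -- The base case of coherence, when no variables are left: maps that agree after the invertible
  -- `ε` agree. As `ε` merges units by `λ⇒`, the cases of `ρₛ`, `αₛ` and `γₛ` rest on `λ-ρ`.
  ε-natural : (φ : S ⟿ T) (e : Empty S) (e′ : Empty T) → ε T e′ ∘ ⟦ φ ⟧₁ ≈ ε S e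
  ε-natural {S} idₛ e e′ = ≈-trans identityʳ (ε-irrelevant S _ _)
  ε-natural (φ ∘ₛ ψ) e e′ =
    ≈-trans (pullˡ (ε-natural φ (λ i → e (move (ψ ⁻¹) i)) e′)) (ε-natural ψ e _)
  ε-natural (φ ⊗ₛ ψ) e e′ =
    ≈-trans assoc (refl⟩∘⟨ ≈-trans (≈-sym ⊗-∘) (ε-natural φ _ _ ⇉ ε-natural ψ _ _))
  ε-natural {T = T} λₛ e e′ = ε-λ T e′ e
  ε-natural {S = S} λₛ⁻¹ e e′ = ≈-trans (≈-sym (ε-λ S e e′) ⟩∘⟨refl) (cancelʳ λ-isoʳ)
  ε-natural {T = T} ρₛ e e′ = ε-ρ T e′ e
  ε-natural {S = S} ρₛ⁻¹ e e′ = ≈-trans (≈-sym (ε-ρ S e e′) ⟩∘⟨refl) (cancelʳ ρ-isoʳ)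
  ε-natural {T = S ⊙ (T ⊙ U)} αₛ e e′ = ε-α S T U e′ e
  ε-natural {S = S ⊙ (T ⊙ U)} αₛ⁻¹ e e′ =
    ≈-trans (≈-sym (ε-α S T U e e′) ⟩∘⟨refl) (cancelʳ α-isoʳ)
  ε-natural {S = S ⊙ T} γₛ e e′ = ε-γ S T e′ e

  -- Both maps must send a chosen variable to its only occurrence in `T`, so pulling it out on both
  -- sides leaves two residual maps with one leaf fewer. Linearity is essential: on a tree of two
  -- equal leaves, `γₛ` and `idₛ` differ in general.
  coherence : Linear T → (φ ψ : S ⟿ T) → ⟦ φ ⟧₁ ≈ ⟦ ψ ⟧₁
  coherence {S = S} = go (size S) refl
    where
    go : ∀ {S T} n → size S ≡ n → Linear T → (φ ψ : S ⟿ T) → ⟦ φ ⟧₁ ≈ ⟦ ψ ⟧₁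
    go {S} {T} n eq d φ ψ with empty? S
    ... | inj₁ none = iso-monic (⁻¹-isoˡ (empty⟿unit T none′))
      (≈-trans (ε-natural φ none none′) (≈-sym (ε-natural ψ none none′)))
      where
      none′ : Empty T
      none′ i = none (move (φ ⁻¹) i)
    go zero eq d φ ψ | inj₂ (_ , _ , i) with () ← trans (sym (size-∖ i)) eq
    go (suc n) eq d φ ψ | inj₂ (_ , _ , i) =
      aligned (∈-unique d (move φ i) (move ψ i)) (residual φ i) (residual ψ i)
        (pull-natural φ i) (pull-natural ψ i)
      where
      -- The occurrences `move φ i` and `move ψ i` are compound expressions, so their equality can
      -- be matched only after abstracting over them, together with the residual maps and squares
      -- whose types mention them.
      aligned : ∀ {j k} → j ≡ k → (φ∖ : _ ∖ i ⟿ _ ∖ j) (ψ∖ : _ ∖ i ⟿ _ ∖ k) →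
                ⟦ pull j ⟧₁ ∘ ⟦ φ ⟧₁ ≈ (id ⊗₁ ⟦ φ∖ ⟧₁) ∘ ⟦ pull i ⟧₁ →
                ⟦ pull k ⟧₁ ∘ ⟦ ψ ⟧₁ ≈ (id ⊗₁ ⟦ ψ∖ ⟧₁) ∘ ⟦ pull i ⟧₁ → ⟦ φ ⟧₁ ≈ ⟦ ψ ⟧₁
      aligned {j} refl φ∖ ψ∖ p q = iso-monic (⁻¹-isoˡ (pull j)) (≈-trans p (≈-trans
        ((≈-refl ⇉ go n (suc-injective (trans (sym (size-∖ i)) eq)) (∖-linear j d) φ∖ ψ∖) ⟩∘⟨refl)
        (≈-sym q)))

-- Coherence of derivations

module TreeTyping (S : Signature) where
  open Signature S
  open Language S hiding (refl; sym; trans)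
  open Trees Var Ty public

  private variable
    x y : Var
    xs : List Var
    A B : Ty
    T T′ T₁ T₂ T₃ T₄ V V′ : Tree
    s t : Term

  -- Covers both patterns and the single variable of a plain `let` alike. The bound variables form
  -- one tree, which structural maps can move as a block.
  data Binds : List Var → Ty → Tree → Set where
    none : Binds [] 𝟙 unit
    one  : Binds (x ∷ []) A (leaf x A)
    two  : Binds (x ∷ y ∷ []) (A ⊗ B) (leaf x A ⊙ leaf y B)

  -- Every rule starts with a structural map, which makes Swap admissible.
  infix 3 _⊩_∶_ _⊩*_∶_
  mutual
    data _⊩_∶_ (T : Tree) : Term → Ty → Set where
      var  : T ⟿ leaf x A → T ⊩ var x ∶ A
      ✶    : T ⟿ unit → T ⊩ ✶ ∶ 𝟙
      gate : ∀ g {ts} → T ⊩* ts ∶ acts g → T ⊩ gate g ts ∶ ⨂ (acts g)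
      pair : T ⟿ T₁ ⊙ T₂ → T₁ ⊩ s ∶ A → T₂ ⊩ t ∶ B → T ⊩ pair s t ∶ A ⊗ B
      letᵖ : ∀ {P} → Binds (vars P) A V → Linear (V ⊙ T₂) → T ⟿ T₁ ⊙ T₂ →
             T₁ ⊩ s ∶ A → V ⊙ T₂ ⊩ t ∶ B → T ⊩ letᵖ[ P ≔ s ] t ∶ B
      let₁ : Binds (x ∷ []) A V → Linear (V ⊙ T₂) → T ⟿ T₁ ⊙ T₂ →
             T₁ ⊩ s ∶ A → V ⊙ T₂ ⊩ t ∶ B → T ⊩ let[ x ≔ s ] t ∶ B

    data _⊩*_∶_ (T : Tree) : ∀ {n} → Vec Term n → Vec Qubit n → Set where
      nil* : T ⟿ unit → T ⊩* [] ∶ []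
      cons* : ∀ {q n} {ts : Vec Term n} {qs} → T ⟿ T₁ ⊙ T₂ →
             T₁ ⊩ t ∶ qubit q → T₂ ⊩* ts ∶ qs → T ⊩* t ∷ ts ∶ q ∷ qs

  reshape : T ⟿ T′ → T′ ⊩ t ∶ A → T ⊩ t ∶ A
  reshape* : ∀ {n} {ts : Vec Term n} {qs} → T ⟿ T′ → T′ ⊩* ts ∶ qs → T ⊩* ts ∶ qs
  reshape φ (var ψ)          = var (ψ ∘ₛ φ)
  reshape φ (✶ ψ)            = ✶ (ψ ∘ₛ φ)
  reshape φ (gate g ts)      = gate g (reshape* φ ts)
  reshape φ (pair ψ s t)     = pair (ψ ∘ₛ φ) s t
  reshape φ (letᵖ b l ψ s t) = letᵖ b l (ψ ∘ₛ φ) s t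
  reshape φ (let₁ b l ψ s t) = let₁ b l (ψ ∘ₛ φ) s t
  reshape* φ (nil* ψ)         = nil* (ψ ∘ₛ φ)
  reshape* φ (cons* ψ t ts)   = cons* (ψ ∘ₛ φ) t ts

  binds-∈ : Binds xs A V → x ∈ᴸ xs → x ∈ₙ V
  binds-∈ one (here refl)         = _ , here
  binds-∈ two (here refl)         = _ , left here
  binds-∈ two (there (here refl)) = _ , right here

  ∈-binds : Binds xs A V → x ∶ B ∈ V → x ∈ᴸ xs
  ∈-binds one here         = here refl
  ∈-binds two (left here)  = here refl
  ∈-binds two (right here) = there (here refl)

  binds-unique : Binds xs A V → Binds xs A V′ → V ≡ V′
  binds-unique none none = refl
  binds-unique one  one  = refl
  binds-unique two  two  = refl

  ∉-bound : Binds xs A V → Linear (V ⊙ T) → x ∶ B ∈ T → x ∉ᴸ xs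
  ∉-bound b (_ , _ , p) i x∈ = p (proj₂ (binds-∈ b x∈)) i

  -- No rule discards a variable: a derivation ends in single leaves and empty trees. Together with
  -- `fv⇒∈`, this makes the term determine the names in its context.
  ∈⇒fv  : T ⊩ t ∶ A → x ∶ B ∈ T → x ∈fv t
  ∈⇒fv* : ∀ {n} {ts : Vec Term n} {qs} → T ⊩* ts ∶ qs → x ∶ B ∈ T → x ∈fv* ts
  ∈⇒fv (var φ) i with here ← move φ i = refl
  ∈⇒fv (✶ φ) i with () ← move φ i
  ∈⇒fv (gate g ts) i = ∈⇒fv* ts i
  ∈⇒fv (pair φ s t) i with move φ i
  ... | left j  = inj₁ (∈⇒fv s j)
  ... | right j = inj₂ (∈⇒fv t j)
  ∈⇒fv (letᵖ b l φ s t) i with move φ i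
  ... | left j  = inj₁ (∈⇒fv s j)
  ... | right j = inj₂ (∉-bound b l j , ∈⇒fv t (right j))
  ∈⇒fv (let₁ b l φ s t) i with move φ i
  ... | left j  = inj₁ (∈⇒fv s j)
  ... | right j = inj₂ ((λ { refl → ∉-bound b l j (here refl) }) , ∈⇒fv t (right j))
  ∈⇒fv* (nil* φ) i with () ← move φ i
  ∈⇒fv* (cons* φ t ts) i with move φ i
  ... | left j  = inj₁ (∈⇒fv t j)
  ... | right j = inj₂ (∈⇒fv* ts j)

  fv⇒∈  : T ⊩ t ∶ A → x ∈fv t → x ∈ₙ T
  fv⇒∈* : ∀ {n} {ts : Vec Term n} {qs} → T ⊩* ts ∶ qs → x ∈fv* ts → x ∈ₙ T
  split-∈ : T ⟿ T₁ ⊙ T₂ → x ∈ₙ T₁ ⊎ x ∈ₙ T₂ → x ∈ₙ T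
  split-∈ φ (inj₁ (A , i)) = A , move (φ ⁻¹) (left i)
  split-∈ φ (inj₂ (A , i)) = A , move (φ ⁻¹) (right i)

  fv⇒∈ (var φ) refl = _ , move (φ ⁻¹) here
  fv⇒∈ (gate g ts) p = fv⇒∈* ts p
  fv⇒∈ (pair φ s t) (inj₁ p) = split-∈ φ (inj₁ (fv⇒∈ s p))
  fv⇒∈ (pair φ s t) (inj₂ p) = split-∈ φ (inj₂ (fv⇒∈ t p))
  fv⇒∈ (letᵖ b l φ s t) (inj₁ p) = split-∈ φ (inj₁ (fv⇒∈ s p))
  fv⇒∈ (letᵖ b l φ s t) (inj₂ (n , p)) with fv⇒∈ t p
  ... | _ , left i  = ⊥-elim (n (∈-binds b i))
  ... | _ , right i = split-∈ φ (inj₂ (_ , i))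
  fv⇒∈ (let₁ b l φ s t) (inj₁ p) = split-∈ φ (inj₁ (fv⇒∈ s p))
  fv⇒∈ (let₁ one l φ s t) (inj₂ (n , p)) with fv⇒∈ t p
  ... | _ , left here = ⊥-elim (n refl)
  ... | _ , right i   = split-∈ φ (inj₂ (_ , i))
  fv⇒∈* (cons* φ t ts) (inj₁ p) = split-∈ φ (inj₁ (fv⇒∈ t p))
  fv⇒∈* (cons* φ t ts) (inj₂ p) = split-∈ φ (inj₂ (fv⇒∈* ts p))

  -- Two derivations may place the same subterm in different trees. Agreement of types on common
  -- names is what passes to subterms, starting from `type-unique` on one linear tree.
  Agree : Tree → Tree → Set
  Agree T T′ = ∀ {x A B} → x ∶ A ∈ T → x ∶ B ∈ T′ → A ≡ B

  agreeˡ : T ⟿ T₁ ⊙ T₂ → T′ ⟿ T₃ ⊙ T₄ → Agree T T′ → Agree T₁ T₃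
  agreeˡ φ ψ a i j = a (move (φ ⁻¹) (left i)) (move (ψ ⁻¹) (left j))

  agreeʳ : T ⟿ T₁ ⊙ T₂ → T′ ⟿ T₃ ⊙ T₄ → Agree T T′ → Agree T₂ T₄
  agreeʳ φ ψ a i j = a (move (φ ⁻¹) (right i)) (move (ψ ⁻¹) (right j))

  agree-⊙ : Linear (V ⊙ T) → Linear (V ⊙ T′) → Agree T T′ → Agree (V ⊙ T) (V ⊙ T′)
  agree-⊙ l l′ a (left i)  (left j)  = type-unique (proj₁ l) i j
  agree-⊙ l l′ a (left i)  (right j) = ⊥-elim (proj₂ (proj₂ l′) i j)
  agree-⊙ l l′ a (right i) (left j)  = ⊥-elim (proj₂ (proj₂ l) j i)
  agree-⊙ l l′ a (right i) (right j) = a i j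

  -- Terms carry no annotations, so a `let` might bind at two types. Settling the type of the bound
  -- term first makes the trees of bound variables equal, and the induction continues in the bodies.
  ⊩-type-unique : Agree T T′ → T ⊩ t ∶ A → T′ ⊩ t ∶ B → A ≡ B
  ⊩-type-unique a (var φ) (var ψ) = a (move (φ ⁻¹) here) (move (ψ ⁻¹) here)
  ⊩-type-unique a (✶ _) (✶ _) = refl
  ⊩-type-unique a (gate g _) (gate .g _) = refl
  ⊩-type-unique a (pair φ s t) (pair ψ s′ t′)
    with refl ← ⊩-type-unique (agreeˡ φ ψ a) s s′ | refl ← ⊩-type-unique (agreeʳ φ ψ a) t t′ = refl
  ⊩-type-unique a (letᵖ b l φ s t) (letᵖ b′ l′ ψ s′ t′)
    with refl ← ⊩-type-unique (agreeˡ φ ψ a) s s′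
    with refl ← binds-unique b b′ = ⊩-type-unique (agree-⊙ l l′ (agreeʳ φ ψ a)) t t′
  ⊩-type-unique a (let₁ b l φ s t) (let₁ b′ l′ ψ s′ t′)
    with refl ← ⊩-type-unique (agreeˡ φ ψ a) s s′
    with refl ← binds-unique b b′ = ⊩-type-unique (agree-⊙ l l′ (agreeʳ φ ψ a)) t t′

  linearˡ : T ⟿ T₁ ⊙ T₂ → Linear T → Linear T₁
  linearˡ φ l = proj₁ (move-linear φ l)

  linearʳ : T ⟿ T₁ ⊙ T₂ → Linear T → Linear T₂
  linearʳ φ l = proj₁ (proj₂ (move-linear φ l))

  same-names : Linear T → Linear T′ → Agree T T′ →
               (∀ {x} → x ∈ₙ T → x ∈ₙ T′) → (∀ {x} → x ∈ₙ T′ → x ∈ₙ T) → T ⟿ T′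
  same-names {T} {T′} l l′ a p q = structural l l′
    (λ {x} i → let (_ , j) = p (_ , i) in ≡-subst (λ A → x ∶ A ∈ T′) (sym (a i j)) j)
    (λ {x} j → let (_ , i) = q (_ , j) in ≡-subst (λ A → x ∶ A ∈ T) (a i j) i)

  same-term : Linear T → Linear T′ → Agree T T′ → T ⊩ t ∶ A → T′ ⊩ t ∶ B → T ⟿ T′
  same-term l l′ a d d′ = same-names l l′ a
    (λ p → fv⇒∈ d′ (∈⇒fv d (proj₂ p))) (λ p → fv⇒∈ d (∈⇒fv d′ (proj₂ p)))

  same-terms : ∀ {n} {ts : Vec Term n} {qs qs′} → Linear T → Linear T′ → Agree T T′ →
               T ⊩* ts ∶ qs → T′ ⊩* ts ∶ qs′ → T ⟿ T′
  same-terms l l′ a d d′ = same-names l l′ a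
    (λ p → fv⇒∈* d′ (∈⇒fv* d (proj₂ p))) (λ p → fv⇒∈* d (∈⇒fv* d′ (proj₂ p)))

  -- The given map may mix the brackets of `V` with the rest, so no restriction can be read off.
  -- Linearity still keeps the variables outside `V` outside, and `structural` builds a new map from
  -- this.
  cancel : Linear (V ⊙ T) → Linear (V ⊙ T′) → V ⊙ T ⟿ V ⊙ T′ → T ⟿ T′
  cancel {V} (_ , l , p) (_ , l′ , p′) φ = structural l l′
    (λ i → go p (move φ (right i)) i) (λ i → go p′ (move (φ ⁻¹) (right i)) i)
    where
    go : ∀ {T T′ x A} → Disjoint V T → x ∶ A ∈ V ⊙ T′ → x ∶ A ∈ T → x ∶ A ∈ T′
    go p (left j)  i = ⊥-elim (p j i)
    go p (right j) i = j

-- Interpretation of tree derivations and its independence of the derivation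

module Semantics {o ℓ e} (S : Signature) (M : Model S o ℓ e) where
  open Signature S
  open Language S hiding (refl; sym; trans)
  open Model M using (smc; X; f; ⟦_⟧ᵗ; cons; canonical) public
  open SMC smc public
  open TreeTyping S public
  open Coherence smc Var Ty ⟦_⟧ᵗ public
  open ≈-Reasoning

  private variable
    xs : List Var
    A B D : Ty
    T T′ T₁ T₂ T₃ T₄ V : Tree
    s t : Term

  -- The identity, but the two objects agree only after a case distinction.
  unpack : Binds xs A V → ⟦ A ⟧ᵗ ⇒ ⟦ V ⟧₀
  unpack none = id
  unpack one  = id
  unpack two  = id

  unpack-unique : (b b′ : Binds xs A V) → unpack b ≈ unpack b′
  unpack-unique none none = ≈-refl
  unpack-unique one  one  = ≈-refl
  unpack-unique two  two  = ≈-refl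

  mutual
    ⟦_⟧ᵈ : T ⊩ t ∶ A → ⟦ T ⟧₀ ⇒ ⟦ A ⟧ᵗ
    ⟦ var φ ⟧ᵈ          = ⟦ φ ⟧₁
    ⟦ ✶ φ ⟧ᵈ            = ⟦ φ ⟧₁
    ⟦ gate g ts ⟧ᵈ      = canonical (acts g) ∘ (f g ∘ ⟦ ts ⟧ᵈ*)
    ⟦ pair φ s t ⟧ᵈ     = (⟦ s ⟧ᵈ ⊗₁ ⟦ t ⟧ᵈ) ∘ ⟦ φ ⟧₁
    ⟦ letᵖ b _ φ s t ⟧ᵈ = ⟦ t ⟧ᵈ ∘ (((unpack b ∘ ⟦ s ⟧ᵈ) ⊗₁ id) ∘ ⟦ φ ⟧₁)
    ⟦ let₁ b _ φ s t ⟧ᵈ = ⟦ t ⟧ᵈ ∘ (((unpack b ∘ ⟦ s ⟧ᵈ) ⊗₁ id) ∘ ⟦ φ ⟧₁)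

    ⟦_⟧ᵈ* : ∀ {n} {ts : Vec Term n} {qs} → T ⊩* ts ∶ qs → ⟦ T ⟧₀ ⇒ ⨂₀ (Vec.map X qs)
    ⟦ nil* φ ⟧ᵈ*                         = ⟦ φ ⟧₁
    ⟦ cons* {q = q} {qs = qs} φ t ts ⟧ᵈ* = cons q qs ∘ ((⟦ t ⟧ᵈ ⊗₁ ⟦ ts ⟧ᵈ*) ∘ ⟦ φ ⟧₁)

  assoc₂ : ∀ {A B D E F} {f : A ⇒ B} {g : B ⇒ D} {h : D ⇒ E} {k : E ⇒ F} →
           (k ∘ (h ∘ g)) ∘ f ≈ k ∘ (h ∘ (g ∘ f))
  assoc₂ = ≈-trans assoc (refl⟩∘⟨ assoc)

  reshape-≈ : (φ : T ⟿ T′) (d : T′ ⊩ t ∶ A) → ⟦ reshape φ d ⟧ᵈ ≈ ⟦ d ⟧ᵈ ∘ ⟦ φ ⟧₁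
  reshape*-≈ : ∀ {n} {ts : Vec Term n} {qs} (φ : T ⟿ T′) (d : T′ ⊩* ts ∶ qs) →
               ⟦ reshape* φ d ⟧ᵈ* ≈ ⟦ d ⟧ᵈ* ∘ ⟦ φ ⟧₁
  reshape-≈ φ (var ψ)          = ≈-refl
  reshape-≈ φ (✶ ψ)            = ≈-refl
  reshape-≈ φ (gate g ts)      = ≈-trans (refl⟩∘⟨ refl⟩∘⟨ reshape*-≈ φ ts) (≈-sym assoc₂)
  reshape-≈ φ (pair ψ s t)     = ≈-sym assoc
  reshape-≈ φ (letᵖ b l ψ s t) = ≈-sym assoc₂
  reshape-≈ φ (let₁ b l ψ s t) = ≈-sym assoc₂
  reshape*-≈ φ (nil* ψ)         = ≈-refl
  reshape*-≈ φ (cons* ψ t ts)   = ≈-sym assoc₂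


  layered : ∀ {X Y} {h : ⟦ T₁ ⟧₀ ⇒ X} {h′ : ⟦ T₃ ⟧₀ ⇒ X} {k : ⟦ T₂ ⟧₀ ⇒ Y} {k′ : ⟦ T₄ ⟧₀ ⇒ Y} →
            Linear T → (φ : T ⟿ T₁ ⊙ T₂) (ψ : T ⟿ T₃ ⊙ T₄) (θ₁ : T₁ ⟿ T₃) (θ₂ : T₂ ⟿ T₄) →
            h ≈ h′ ∘ ⟦ θ₁ ⟧₁ → k ≈ k′ ∘ ⟦ θ₂ ⟧₁ →
            (h ⊗₁ k) ∘ ⟦ φ ⟧₁ ≈ (h′ ⊗₁ k′) ∘ ⟦ ψ ⟧₁
  layered {h = h} {h′} {k} {k′} l φ ψ θ₁ θ₂ p q = begin
    (h ⊗₁ k) ∘ ⟦ φ ⟧₁                                  ≈⟨ ≈-trans (p ⇉ q) ⊗-∘ ⟩∘⟨refl ⟩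
    ((h′ ⊗₁ k′) ∘ (⟦ θ₁ ⟧₁ ⊗₁ ⟦ θ₂ ⟧₁)) ∘ ⟦ φ ⟧₁       ≈⟨ assoc ⟩
    (h′ ⊗₁ k′) ∘ ⟦ (θ₁ ⊗ₛ θ₂) ∘ₛ φ ⟧₁
      ≈⟨ refl⟩∘⟨ coherence (move-linear ψ l) ((θ₁ ⊗ₛ θ₂) ∘ₛ φ) ψ ⟩
    (h′ ⊗₁ k′) ∘ ⟦ ψ ⟧₁                                ∎

  -- The comparison `ω` of the body contexts need not visibly fix `V`. Coherence replaces it by
  -- `idₛ ⊗ₛ θ₂`, which slides past the bound term and leaves a case of `layered`.
  layered-let : ∀ {X} {h : ⟦ T₁ ⟧₀ ⇒ ⟦ V ⟧₀} {h′ : ⟦ T₃ ⟧₀ ⇒ ⟦ V ⟧₀}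
                {k : ⟦ V ⊙ T₂ ⟧₀ ⇒ X} {k′ : ⟦ V ⊙ T₄ ⟧₀ ⇒ X} →
                Linear T → Linear (V ⊙ T₂) → Linear (V ⊙ T₄) →
                (φ : T ⟿ T₁ ⊙ T₂) (ψ : T ⟿ T₃ ⊙ T₄) (θ : T₁ ⟿ T₃) (ω : V ⊙ T₂ ⟿ V ⊙ T₄) →
                h ≈ h′ ∘ ⟦ θ ⟧₁ → k ≈ k′ ∘ ⟦ ω ⟧₁ →
                k ∘ ((h ⊗₁ id) ∘ ⟦ φ ⟧₁) ≈ k′ ∘ ((h′ ⊗₁ id) ∘ ⟦ ψ ⟧₁)
  layered-let {V = V} {h = h} {h′} {k} {k′} l l₂ l₄ φ ψ θ ω p q = begin
    k ∘ ((h ⊗₁ id) ∘ ⟦ φ ⟧₁)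
      ≈⟨ ≈-trans q (refl⟩∘⟨ coherence l₄ ω (idₛ ⊗ₛ θ₂)) ⟩∘⟨refl ⟩
    (k′ ∘ (id ⊗₁ ⟦ θ₂ ⟧₁)) ∘ ((h ⊗₁ id) ∘ ⟦ φ ⟧₁)           ≈⟨ ≈-trans assoc (refl⟩∘⟨ pullˡ ⊗-second) ⟩
    k′ ∘ ((h ⊗₁ ⟦ θ₂ ⟧₁) ∘ ⟦ φ ⟧₁)
      ≈⟨ refl⟩∘⟨ layered l φ ψ θ θ₂ p (≈-sym identityˡ) ⟩
    k′ ∘ ((h′ ⊗₁ id) ∘ ⟦ ψ ⟧₁)                              ∎
    where θ₂ = cancel l₂ l₄ ω

  ⊩-coherence  : Linear T → (d d′ : T ⊩ t ∶ A) → ⟦ d ⟧ᵈ ≈ ⟦ d′ ⟧ᵈ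
  ⊩*-coherence : ∀ {n} {ts : Vec Term n} {qs} → Linear T →
                 (d d′ : T ⊩* ts ∶ qs) → ⟦ d ⟧ᵈ* ≈ ⟦ d′ ⟧ᵈ*
  ⊩-coherence l (var φ)     (var ψ)      = coherence tt φ ψ
  ⊩-coherence l (✶ φ)       (✶ ψ)        = coherence tt φ ψ
  ⊩-coherence l (gate g ts) (gate g ts′) = refl⟩∘⟨ refl⟩∘⟨ ⊩*-coherence l ts ts′
  ⊩-coherence l (pair φ s t) (pair ψ s′ t′) = layered l φ ψ θ₁ θ₂
    (≈-trans (⊩-coherence (linearˡ φ l) s (reshape θ₁ s′)) (reshape-≈ θ₁ s′))
    (≈-trans (⊩-coherence (linearʳ φ l) t (reshape θ₂ t′)) (reshape-≈ θ₂ t′))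
    where
    θ₁ = same-term (linearˡ φ l) (linearˡ ψ l) (agreeˡ φ ψ (type-unique l)) s s′
    θ₂ = same-term (linearʳ φ l) (linearʳ ψ l) (agreeʳ φ ψ (type-unique l)) t t′
  ⊩-coherence l (letᵖ b l₂ φ s t) (letᵖ b′ l₄ ψ s′ t′)
    with refl ← ⊩-type-unique (agreeˡ φ ψ (type-unique l)) s s′
    with refl ← binds-unique b b′ = layered-let l l₂ l₄ φ ψ θ ω
    (≈-trans (unpack-unique b b′ ⟩∘⟨
      ≈-trans (⊩-coherence (linearˡ φ l) s (reshape θ s′)) (reshape-≈ θ s′)) (≈-sym assoc))
    (≈-trans (⊩-coherence l₂ t (reshape ω t′)) (reshape-≈ ω t′))
    where
    θ = same-term (linearˡ φ l) (linearˡ ψ l) (agreeˡ φ ψ (type-unique l)) s s′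
    ω = same-term l₂ l₄ (agree-⊙ l₂ l₄ (agreeʳ φ ψ (type-unique l))) t t′
  ⊩-coherence l (let₁ b l₂ φ s t) (let₁ b′ l₄ ψ s′ t′)
    with refl ← ⊩-type-unique (agreeˡ φ ψ (type-unique l)) s s′
    with refl ← binds-unique b b′ = layered-let l l₂ l₄ φ ψ θ ω
    (≈-trans (unpack-unique b b′ ⟩∘⟨
      ≈-trans (⊩-coherence (linearˡ φ l) s (reshape θ s′)) (reshape-≈ θ s′)) (≈-sym assoc))
    (≈-trans (⊩-coherence l₂ t (reshape ω t′)) (reshape-≈ ω t′))
    where
    θ = same-term (linearˡ φ l) (linearˡ ψ l) (agreeˡ φ ψ (type-unique l)) s s′
    ω = same-term l₂ l₄ (agree-⊙ l₂ l₄ (agreeʳ φ ψ (type-unique l))) t t′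
  ⊩*-coherence l (nil* φ) (nil* ψ) = coherence tt φ ψ
  ⊩*-coherence l (cons* φ t ts) (cons* ψ t′ ts′) = refl⟩∘⟨ layered l φ ψ θ₁ θ₂
    (≈-trans (⊩-coherence (linearˡ φ l) t (reshape θ₁ t′)) (reshape-≈ θ₁ t′))
    (≈-trans (⊩*-coherence (linearʳ φ l) ts (reshape* θ₂ ts′)) (reshape*-≈ θ₂ ts′))
    where
    θ₁ = same-term (linearˡ φ l) (linearˡ ψ l) (agreeˡ φ ψ (type-unique l)) t t′
    θ₂ = same-terms (linearʳ φ l) (linearʳ ψ l) (agreeʳ φ ψ (type-unique l)) ts ts′

-- Substitution

module Substitution {o ℓ e} (S : Signature) (M : Model S o ℓ e) where
  open Signature S
  open Language S hiding (refl; sym; trans)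
  open Semantics S M hiding (_∖_) public
  open ≈-Reasoning

  private variable
    x z : Var
    xs : List Var
    A B : Ty
    T T′ T₁ T₂ T₃ T₄ V W : Tree
    s t : Term
    σ τ : Subst

  -- A substitution as a morphism: `T` is split along the shape of the target, with a derivation at
  -- each leaf. The equation in `leafˢ` is there because `σ x` reduces only after a decision on
  -- names.
  data Substitutes (σ : Subst) (T : Tree) : Tree → Set where
    unitˢ : T ⟿ unit → Substitutes σ T unit
    leafˢ : σ x ≡ s → T ⊩ s ∶ A → Substitutes σ T (leaf x A)
    splitˢ : T ⟿ T₁ ⊙ T₂ → Substitutes σ T₁ V → Substitutes σ T₂ W → Substitutes σ T (V ⊙ W)

  ⟦_⟧ˢ : Substitutes σ T V → ⟦ T ⟧₀ ⇒ ⟦ V ⟧₀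
  ⟦ unitˢ φ ⟧ˢ      = ⟦ φ ⟧₁
  ⟦ leafˢ _ d ⟧ˢ    = ⟦ d ⟧ᵈ
  ⟦ splitˢ φ a b ⟧ˢ = (⟦ a ⟧ˢ ⊗₁ ⟦ b ⟧ˢ) ∘ ⟦ φ ⟧₁

  reshapeˢ : T ⟿ T′ → Substitutes σ T′ V → Substitutes σ T V
  reshapeˢ φ (unitˢ ψ)      = unitˢ (ψ ∘ₛ φ)
  reshapeˢ φ (leafˢ p d)    = leafˢ p (reshape φ d)
  reshapeˢ φ (splitˢ ψ a b) = splitˢ (ψ ∘ₛ φ) a b

  reshapeˢ-≈ : (φ : T ⟿ T′) (a : Substitutes σ T′ V) → ⟦ reshapeˢ φ a ⟧ˢ ≈ ⟦ a ⟧ˢ ∘ ⟦ φ ⟧₁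
  reshapeˢ-≈ φ (unitˢ ψ)      = ≈-refl
  reshapeˢ-≈ φ (leafˢ p d)    = reshape-≈ φ d
  reshapeˢ-≈ φ (splitˢ ψ a b) = ≈-sym assoc

  -- Each rule splits its context along a structural map, so a substitution into that context must
  -- be carried along the map before it can be distributed over the premises.
  retarget : V ⟿ W → Substitutes σ T V → Substitutes σ T W
  retarget idₛ      a                         = a
  retarget (φ ∘ₛ ψ) a                         = retarget φ (retarget ψ a)
  retarget (φ ⊗ₛ ψ) (splitˢ χ a b)             = splitˢ χ (retarget φ a) (retarget ψ b)
  retarget λₛ       (splitˢ χ (unitˢ ω) a)      = reshapeˢ (λₛ ∘ₛ ((ω ⊗ₛ idₛ) ∘ₛ χ)) a
  retarget λₛ⁻¹     a                         = splitˢ λₛ⁻¹ (unitˢ idₛ) a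
  retarget ρₛ       (splitˢ χ a (unitˢ ω))      = reshapeˢ (ρₛ ∘ₛ ((idₛ ⊗ₛ ω) ∘ₛ χ)) a
  retarget ρₛ⁻¹     a                         = splitˢ ρₛ⁻¹ a (unitˢ idₛ)
  retarget αₛ       (splitˢ χ (splitˢ ω a b) c) = splitˢ (αₛ ∘ₛ ((ω ⊗ₛ idₛ) ∘ₛ χ)) a (splitˢ idₛ b c)
  retarget αₛ⁻¹     (splitˢ χ a (splitˢ ω b c)) = splitˢ (αₛ⁻¹ ∘ₛ ((idₛ ⊗ₛ ω) ∘ₛ χ)) (splitˢ idₛ a b) c
  retarget γₛ       (splitˢ χ a b)             = splitˢ (γₛ ∘ₛ χ) b a

  retarget-≈ : (φ : V ⟿ W) (a : Substitutes σ T V) → ⟦ retarget φ a ⟧ˢ ≈ ⟦ φ ⟧₁ ∘ ⟦ a ⟧ˢ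
  retarget-≈ idₛ a = ≈-sym identityˡ
  retarget-≈ (φ ∘ₛ ψ) a =
    ≈-trans (retarget-≈ φ (retarget ψ a)) (≈-trans (refl⟩∘⟨ retarget-≈ ψ a) (≈-sym assoc))
  retarget-≈ (φ ⊗ₛ ψ) (splitˢ χ a b) =
    pushˡ (≈-trans (retarget-≈ φ a ⇉ retarget-≈ ψ b) ⊗-∘)
  retarget-≈ λₛ (splitˢ χ (unitˢ ω) a) = begin
    ⟦ reshapeˢ (λₛ ∘ₛ ((ω ⊗ₛ idₛ) ∘ₛ χ)) a ⟧ˢ          ≈⟨ reshapeˢ-≈ _ a ⟩
    ⟦ a ⟧ˢ ∘ (λ⇒ ∘ ((⟦ ω ⟧₁ ⊗₁ id) ∘ ⟦ χ ⟧₁))          ≈⟨ extendˡ λ-natural ⟨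
    λ⇒ ∘ ((id ⊗₁ ⟦ a ⟧ˢ) ∘ ((⟦ ω ⟧₁ ⊗₁ id) ∘ ⟦ χ ⟧₁))  ≈⟨ refl⟩∘⟨ pullˡ ⊗-second ⟩
    λ⇒ ∘ ((⟦ ω ⟧₁ ⊗₁ ⟦ a ⟧ˢ) ∘ ⟦ χ ⟧₁)                 ∎
  retarget-≈ λₛ⁻¹ a = square⁻¹ λ-isoʳ λ-isoˡ (≈-sym λ-natural)
  retarget-≈ ρₛ (splitˢ χ a (unitˢ ω)) = begin
    ⟦ reshapeˢ (ρₛ ∘ₛ ((idₛ ⊗ₛ ω) ∘ₛ χ)) a ⟧ˢ          ≈⟨ reshapeˢ-≈ _ a ⟩
    ⟦ a ⟧ˢ ∘ (ρ⇒ ∘ ((id ⊗₁ ⟦ ω ⟧₁) ∘ ⟦ χ ⟧₁))          ≈⟨ extendˡ ρ-natural ⟨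
    ρ⇒ ∘ ((⟦ a ⟧ˢ ⊗₁ id) ∘ ((id ⊗₁ ⟦ ω ⟧₁) ∘ ⟦ χ ⟧₁))  ≈⟨ refl⟩∘⟨ pullˡ ⊗-first ⟩
    ρ⇒ ∘ ((⟦ a ⟧ˢ ⊗₁ ⟦ ω ⟧₁) ∘ ⟦ χ ⟧₁)                 ∎
  retarget-≈ ρₛ⁻¹ a = square⁻¹ ρ-isoʳ ρ-isoˡ (≈-sym ρ-natural)
  retarget-≈ αₛ (splitˢ χ (splitˢ ω a b) c) = begin
    (⟦ a ⟧ˢ ⊗₁ ((⟦ b ⟧ˢ ⊗₁ ⟦ c ⟧ˢ) ∘ id)) ∘ (α⇒ ∘ ((⟦ ω ⟧₁ ⊗₁ id) ∘ ⟦ χ ⟧₁))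
      ≈⟨ (≈-refl ⇉ identityʳ) ⟩∘⟨refl ⟩
    (⟦ a ⟧ˢ ⊗₁ (⟦ b ⟧ˢ ⊗₁ ⟦ c ⟧ˢ)) ∘ (α⇒ ∘ ((⟦ ω ⟧₁ ⊗₁ id) ∘ ⟦ χ ⟧₁))        ≈⟨ extendˡ α-natural ⟨
    α⇒ ∘ (((⟦ a ⟧ˢ ⊗₁ ⟦ b ⟧ˢ) ⊗₁ ⟦ c ⟧ˢ) ∘ ((⟦ ω ⟧₁ ⊗₁ id) ∘ ⟦ χ ⟧₁))
      ≈⟨ refl⟩∘⟨ pullˡ (≈-trans (≈-sym ⊗-∘) (≈-refl ⇉ identityʳ)) ⟩
    α⇒ ∘ ((((⟦ a ⟧ˢ ⊗₁ ⟦ b ⟧ˢ) ∘ ⟦ ω ⟧₁) ⊗₁ ⟦ c ⟧ˢ) ∘ ⟦ χ ⟧₁)                ∎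
  retarget-≈ αₛ⁻¹ (splitˢ χ a (splitˢ ω b c)) = begin
    (((⟦ a ⟧ˢ ⊗₁ ⟦ b ⟧ˢ) ∘ id) ⊗₁ ⟦ c ⟧ˢ) ∘ (α⇐ ∘ ((id ⊗₁ ⟦ ω ⟧₁) ∘ ⟦ χ ⟧₁))
      ≈⟨ (identityʳ ⇉ ≈-refl) ⟩∘⟨refl ⟩
    ((⟦ a ⟧ˢ ⊗₁ ⟦ b ⟧ˢ) ⊗₁ ⟦ c ⟧ˢ) ∘ (α⇐ ∘ ((id ⊗₁ ⟦ ω ⟧₁) ∘ ⟦ χ ⟧₁))
      ≈⟨ extendˡ (square⁻¹ α-isoʳ α-isoˡ (≈-sym α-natural)) ⟩
    α⇐ ∘ ((⟦ a ⟧ˢ ⊗₁ (⟦ b ⟧ˢ ⊗₁ ⟦ c ⟧ˢ)) ∘ ((id ⊗₁ ⟦ ω ⟧₁) ∘ ⟦ χ ⟧₁))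
      ≈⟨ refl⟩∘⟨ pullˡ (≈-trans (≈-sym ⊗-∘) (identityʳ ⇉ ≈-refl)) ⟩
    α⇐ ∘ ((⟦ a ⟧ˢ ⊗₁ ((⟦ b ⟧ˢ ⊗₁ ⟦ c ⟧ˢ) ∘ ⟦ ω ⟧₁)) ∘ ⟦ χ ⟧₁)                ∎
  retarget-≈ γₛ (splitˢ χ a b) = extendˡ (≈-sym γ-natural)

  identityˢ : (∀ {x A} → x ∶ A ∈ T → σ x ≡ var x) → Substitutes σ T T
  identityˢ {T = unit}     p = unitˢ idₛ
  identityˢ {T = leaf _ _} p = leafˢ (p here) (var idₛ)
  identityˢ {T = _ ⊙ _}    p =
    splitˢ idₛ (identityˢ (λ i → p (left i))) (identityˢ (λ i → p (right i)))

  identityˢ-≈ : (p : ∀ {x A} → x ∶ A ∈ T → σ x ≡ var x) → ⟦ identityˢ p ⟧ˢ ≈ id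
  identityˢ-≈ {T = unit}     p = ≈-refl
  identityˢ-≈ {T = leaf _ _} p = ≈-refl
  identityˢ-≈ {T = _ ⊙ _}    p = ≈-trans identityʳ
    (≈-trans (identityˢ-≈ (λ i → p (left i)) ⇉ identityˢ-≈ (λ i → p (right i))) ⊗-id)

  respecify : (∀ {x A} → x ∶ A ∈ V → τ x ≡ σ x) → Substitutes σ T V → Substitutes τ T V
  respecify p (unitˢ φ)      = unitˢ φ
  respecify p (leafˢ q d)    = leafˢ (trans (p here) q) d
  respecify p (splitˢ φ a b) =
    splitˢ φ (respecify (λ i → p (left i)) a) (respecify (λ i → p (right i)) b)

  respecify-≈ : (p : ∀ {x A} → x ∶ A ∈ V → τ x ≡ σ x) (a : Substitutes σ T V) →
                ⟦ respecify {τ = τ} p a ⟧ˢ ≈ ⟦ a ⟧ˢ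
  respecify-≈ p (unitˢ φ)      = ≈-refl
  respecify-≈ p (leafˢ q d)    = ≈-refl
  respecify-≈ p (splitˢ φ a b) =
    (respecify-≈ (λ i → p (left i)) a ⇉ respecify-≈ (λ i → p (right i)) b) ⟩∘⟨refl

  ∖-bound : ∀ σ → x ∈ᴸ xs → (σ ∖ xs) x ≡ var x
  ∖-bound {x = x} {xs} σ p with x ∈? xs
  ... | yes _ = refl
  ... | no q  = ⊥-elim (q p)

  ∖-free : ∀ σ → x ∉ᴸ xs → (σ ∖ xs) x ≡ σ x
  ∖-free {x = x} {xs} σ p with x ∈? xs
  ... | yes q = ⊥-elim (p q)
  ... | no _  = refl

  under : Binds xs A V → Linear (V ⊙ W) → Substitutes σ T W → Substitutes (σ ∖ xs) (V ⊙ T) (V ⊙ W)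
  under {xs = xs} {σ = σ} b l a = splitˢ idₛ (identityˢ λ i → ∖-bound σ (∈-binds b i))
    (respecify (λ i → ∖-free σ (∉-bound b l i)) a)

  under-≈ : (b : Binds xs A V) (l : Linear (V ⊙ W)) (a : Substitutes σ T W) →
            ⟦ under b l a ⟧ˢ ≈ id ⊗₁ ⟦ a ⟧ˢ
  under-≈ {σ = σ} b l a = ≈-trans identityʳ
    (identityˢ-≈ (λ i → ∖-bound σ (∈-binds b i)) ⇉ respecify-≈ (λ i → ∖-free σ (∉-bound b l i)) a)

  origin : Substitutes σ T V → x ∶ A ∈ T → ∃ λ z → z ∈ₙ V × x ∈fv σ z
  origin (unitˢ φ) i with () ← move φ i
  origin (leafˢ refl d) i = _ , (_ , here) , ∈⇒fv d i
  origin (splitˢ φ a b) i with move φ i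
  ... | left j  = let (z , (B , k) , p) = origin a j in z , (B , left k) , p
  ... | right j = let (z , (B , k) , p) = origin b j in z , (B , right k) , p

  -- Absence of capture keeps the body's context linear: by `origin`, a variable of `T` that clashes
  -- with a bound one would be free in some `σ z`, where `z` is free in `t` and not bound.
  under-linear : Binds xs A V → Linear (V ⊙ W) → V ⊙ W ⊩ t ∶ B →
                 Substitutes σ T W → NoCaptureUnder xs σ t → Linear T → Linear (V ⊙ T)
  under-linear b l d a nc lT = proj₁ l , lT , λ i j →
    let (z , (_ , k) , p) = origin a j
    in All.lookup (nc z (∈⇒fv d (right k)) (∉-bound b l k)) (∈-binds b i) p

  substitute-let : ∀ {X} {h : ⟦ T₁ ⟧₀ ⇒ ⟦ V ⟧₀} {h′ : ⟦ T₃ ⟧₀ ⇒ ⟦ V ⟧₀}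
                   {k : ⟦ V ⊙ T₂ ⟧₀ ⇒ X} {k′ : ⟦ V ⊙ T₄ ⟧₀ ⇒ X} →
                   (φ : T ⟿ T₁ ⊙ T₂) (a : Substitutes σ T′ T) (χ : T′ ⟿ T₃ ⊙ T₄)
                   (a₁ : Substitutes σ T₃ T₁) (a₂ : Substitutes σ T₄ T₂) →
                   ⟦ splitˢ χ a₁ a₂ ⟧ˢ ≈ ⟦ φ ⟧₁ ∘ ⟦ a ⟧ˢ →
                   h′ ≈ h ∘ ⟦ a₁ ⟧ˢ → k′ ≈ k ∘ (id ⊗₁ ⟦ a₂ ⟧ˢ) →
                   k′ ∘ ((h′ ⊗₁ id) ∘ ⟦ χ ⟧₁) ≈ (k ∘ ((h ⊗₁ id) ∘ ⟦ φ ⟧₁)) ∘ ⟦ a ⟧ˢ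
  substitute-let {h = h} {h′} {k} {k′} φ a χ a₁ a₂ r p q = begin
    k′ ∘ ((h′ ⊗₁ id) ∘ ⟦ χ ⟧₁)                                    ≈⟨ pushˡ q ⟩
    k ∘ ((id ⊗₁ ⟦ a₂ ⟧ˢ) ∘ ((h′ ⊗₁ id) ∘ ⟦ χ ⟧₁))
      ≈⟨ refl⟩∘⟨ pullˡ (≈-trans ⊗-second (≈-trans (p ⇉ ≈-sym identityˡ) ⊗-∘)) ⟩
    k ∘ (((h ⊗₁ id) ∘ (⟦ a₁ ⟧ˢ ⊗₁ ⟦ a₂ ⟧ˢ)) ∘ ⟦ χ ⟧₁)             ≈⟨ refl⟩∘⟨ assoc ⟩
    k ∘ ((h ⊗₁ id) ∘ ((⟦ a₁ ⟧ˢ ⊗₁ ⟦ a₂ ⟧ˢ) ∘ ⟦ χ ⟧₁))             ≈⟨ refl⟩∘⟨ refl⟩∘⟨ r ⟩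
    k ∘ ((h ⊗₁ id) ∘ (⟦ φ ⟧₁ ∘ ⟦ a ⟧ˢ))                           ≈⟨ assoc₂ ⟨
    (k ∘ ((h ⊗₁ id) ∘ ⟦ φ ⟧₁)) ∘ ⟦ a ⟧ˢ                           ∎

  substitute-pair : ∀ {X Y} {h : ⟦ T₁ ⟧₀ ⇒ X} {h′ : ⟦ T₃ ⟧₀ ⇒ X} {k : ⟦ T₂ ⟧₀ ⇒ Y} {k′ : ⟦ T₄ ⟧₀ ⇒ Y} →
                    (φ : T ⟿ T₁ ⊙ T₂) (a : Substitutes σ T′ T) (χ : T′ ⟿ T₃ ⊙ T₄)
                    (a₁ : Substitutes σ T₃ T₁) (a₂ : Substitutes σ T₄ T₂) →
                    ⟦ splitˢ χ a₁ a₂ ⟧ˢ ≈ ⟦ φ ⟧₁ ∘ ⟦ a ⟧ˢ →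
                    h′ ≈ h ∘ ⟦ a₁ ⟧ˢ → k′ ≈ k ∘ ⟦ a₂ ⟧ˢ →
                    (h′ ⊗₁ k′) ∘ ⟦ χ ⟧₁ ≈ ((h ⊗₁ k) ∘ ⟦ φ ⟧₁) ∘ ⟦ a ⟧ˢ
  substitute-pair {h = h} {h′} {k} {k′} φ a χ a₁ a₂ r p q = begin
    (h′ ⊗₁ k′) ∘ ⟦ χ ⟧₁                                   ≈⟨ pushˡ (≈-trans (p ⇉ q) ⊗-∘) ⟩
    (h ⊗₁ k) ∘ ((⟦ a₁ ⟧ˢ ⊗₁ ⟦ a₂ ⟧ˢ) ∘ ⟦ χ ⟧₁)            ≈⟨ refl⟩∘⟨ r ⟩
    (h ⊗₁ k) ∘ (⟦ φ ⟧₁ ∘ ⟦ a ⟧ˢ)                          ≈⟨ assoc ⟨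
    ((h ⊗₁ k) ∘ ⟦ φ ⟧₁) ∘ ⟦ a ⟧ˢ                          ∎

  -- The derivation and the equation for its meaning are built together, because the substituted
  -- derivation takes its splits from the retargeted substitution.
  substitute : (d : V ⊩ t ∶ A) (a : Substitutes σ T V) → Linear T → NoCapture σ t →
               Σ (T ⊩ subst σ t ∶ A) λ d′ → ⟦ d′ ⟧ᵈ ≈ ⟦ d ⟧ᵈ ∘ ⟦ a ⟧ˢ
  substitute* : ∀ {n} {ts : Vec Term n} {qs} (d : V ⊩* ts ∶ qs) (a : Substitutes σ T V) →
                Linear T → NoCapture* σ ts →
                Σ (T ⊩* subst* σ ts ∶ qs) λ d′ → ⟦ d′ ⟧ᵈ* ≈ ⟦ d ⟧ᵈ* ∘ ⟦ a ⟧ˢ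
  substitute (var φ) a l nc with retarget φ a | retarget-≈ φ a
  ... | leafˢ refl d | p = d , p
  substitute (✶ φ) a l nc with retarget φ a | retarget-≈ φ a
  ... | unitˢ ψ | p = ✶ ψ , p
  substitute (gate g ts) a l nc =
    let (ts′ , p) = substitute* ts a l nc
    in gate g ts′ , ≈-trans (refl⟩∘⟨ refl⟩∘⟨ p) (≈-sym assoc₂)
  substitute (pair φ s t) a l (nc , nc′) with retarget φ a | retarget-≈ φ a
  ... | splitˢ χ a₁ a₂ | r =
    let (s′ , p) = substitute s a₁ (linearˡ χ l) nc
        (t′ , q) = substitute t a₂ (linearʳ χ l) nc′
    in pair χ s′ t′ , substitute-pair φ a χ a₁ a₂ r p q
  substitute (letᵖ {V = V} {P = P} b lV φ s t) a l (nc , ncu , nc′) with retarget φ a | retarget-≈ φ a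
  ... | splitˢ χ a₁ a₂ | r =
    let lV′ = under-linear b lV t a₂ ncu (linearʳ χ l)
        (s′ , p) = substitute s a₁ (linearˡ χ l) nc
        (t′ , q) = substitute t (under b lV a₂) lV′ nc′
    in letᵖ {P = P} b lV′ χ s′ t′ , substitute-let {V = V} φ a χ a₁ a₂ r
         (≈-trans (refl⟩∘⟨ p) (≈-sym assoc)) (≈-trans q (refl⟩∘⟨ under-≈ b lV a₂))
  substitute (let₁ {V = V} b lV φ s t) a l (nc , ncu , nc′) with retarget φ a | retarget-≈ φ a
  ... | splitˢ χ a₁ a₂ | r =
    let lV′ = under-linear b lV t a₂ ncu (linearʳ χ l)
        (s′ , p) = substitute s a₁ (linearˡ χ l) nc
        (t′ , q) = substitute t (under b lV a₂) lV′ nc′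
    in let₁ b lV′ χ s′ t′ , substitute-let {V = V} φ a χ a₁ a₂ r
         (≈-trans (refl⟩∘⟨ p) (≈-sym assoc)) (≈-trans q (refl⟩∘⟨ under-≈ b lV a₂))
  substitute* (nil* φ) a l nc with retarget φ a | retarget-≈ φ a
  ... | unitˢ ψ | p = nil* ψ , p
  substitute* (cons* φ t ts) a l (nc , nc′) with retarget φ a | retarget-≈ φ a
  ... | splitˢ χ a₁ a₂ | r =
    let (t′ , p)  = substitute t a₁ (linearˡ χ l) nc
        (ts′ , q) = substitute* ts a₂ (linearʳ χ l) nc′
    in cons* χ t′ ts′ , ≈-trans (refl⟩∘⟨ substitute-pair φ a χ a₁ a₂ r p q) (≈-sym assoc)

-- Generating equations

module Axioms {o ℓ e} (S : Signature) (M : Model S o ℓ e) where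
  open Signature S
  open Language S hiding (refl; sym; trans; _∖_)
  open Substitution S M public
  open ≈-Reasoning

  private variable
    x y z x′ y′ : Var
    xs : List Var
    A B D : Ty
    T T₁ T₂ T₃ T₄ V V′ W W′ : Tree
    s t u : Term
    σ τ : Subst

  factor : Linear V → V ⊆ T → ∃ λ W → T ⟿ V ⊙ W
  factor {unit}     l p = _ , λₛ⁻¹
  factor {leaf _ _} l p = _ , pull (p here)
  factor {V ⊙ V′} {T} (l , l′ , d) p =
    let (W , φ) = factor l (λ i → p (left i))
        (W′ , ψ) = factor l′ (rest φ)
    in W′ , αₛ⁻¹ ∘ₛ ((idₛ ⊗ₛ ψ) ∘ₛ φ)
    where
    rest : ∀ {W} → T ⟿ V ⊙ W → V′ ⊆ W
    rest φ i with move φ (p (right i))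
    ... | left j  = ⊥-elim (d j i)
    ... | right j = j

  -- As `V` misses `T₄`, all of it lies in `T₃`, and factoring it out there leaves `W`. Cancelling
  -- `V` from the resulting map into `V ⊙ (W ⊙ T₄)` divides `T₂`.
  divide : Linear (V ⊙ T₂) → V ⊙ T₂ ⟿ T₃ ⊙ T₄ → Disjoint V T₄ →
           ∃ λ W → (V ⊙ W ⟿ T₃) × (T₂ ⟿ W ⊙ T₄)
  divide {V} {T₂} {T₃} {T₄} l ψ p =
    let (W , χ) = factor (proj₁ l) inside
        ω = αₛ ∘ₛ ((χ ⊗ₛ idₛ) ∘ₛ ψ)
    in W , χ ⁻¹ , cancel l (move-linear ω l) ω
    where
    inside : V ⊆ T₃
    inside i with move ψ (left i)
    ... | left j  = j
    ... | right j = ⊥-elim (p i j)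

  -- The categorical content of the commuting conversions: h is the box s of
  -- let P = s, and V are the variables of P, none of which is used by m.
  push-left : Linear (V ⊙ T₂) → (φ : T ⟿ T₁ ⊙ T₂) (ψ : V ⊙ T₂ ⟿ T₃ ⊙ T₄) → Disjoint V T₄ →
              ∃ λ W → Σ (V ⊙ W ⟿ T₃) λ χ → Σ (T ⟿ (T₁ ⊙ W) ⊙ T₄) λ ω →
              ∀ {X Y} {h : ⟦ T₁ ⟧₀ ⇒ ⟦ V ⟧₀} {k : ⟦ T₃ ⟧₀ ⇒ X} {m : ⟦ T₄ ⟧₀ ⇒ Y} →
              ((k ⊗₁ m) ∘ ⟦ ψ ⟧₁) ∘ ((h ⊗₁ id) ∘ ⟦ φ ⟧₁) ≈
              ((k ∘ (⟦ χ ⟧₁ ∘ (h ⊗₁ id))) ⊗₁ m) ∘ ⟦ ω ⟧₁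
  push-left {V} {T₂} {T} {T₁} {T₃} {T₄} l φ ψ p =
    let (W , χ , θ) = divide l ψ p in W , χ , αₛ⁻¹ ∘ₛ ((idₛ ⊗ₛ θ) ∘ₛ φ) , λ {X} {Y} {h} {k} {m} → begin
    ((k ⊗₁ m) ∘ ⟦ ψ ⟧₁) ∘ ((h ⊗₁ id) ∘ ⟦ φ ⟧₁)
      ≈⟨ assoc ⟩
    (k ⊗₁ m) ∘ (⟦ ψ ⟧₁ ∘ ((h ⊗₁ id) ∘ ⟦ φ ⟧₁))
      -- Coherence replaces `ψ` by a map that leaves `V` alone until `χ`, so that `h` can move up to
      -- `χ` by naturality.
      ≈⟨ refl⟩∘⟨ coherence (move-linear ψ l) ψ ((χ ⊗ₛ idₛ) ∘ₛ (αₛ⁻¹ ∘ₛ (idₛ ⊗ₛ θ))) ⟩∘⟨refl ⟩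
    (k ⊗₁ m) ∘ (((⟦ χ ⟧₁ ⊗₁ id) ∘ (α⇐ ∘ (id ⊗₁ ⟦ θ ⟧₁))) ∘ ((h ⊗₁ id) ∘ ⟦ φ ⟧₁))
      ≈⟨ refl⟩∘⟨ assoc₂ ⟩
    (k ⊗₁ m) ∘ ((⟦ χ ⟧₁ ⊗₁ id) ∘ (α⇐ ∘ ((id ⊗₁ ⟦ θ ⟧₁) ∘ ((h ⊗₁ id) ∘ ⟦ φ ⟧₁))))
      ≈⟨ refl⟩∘⟨ refl⟩∘⟨ refl⟩∘⟨ extendˡ (≈-sym interchange) ⟩
    (k ⊗₁ m) ∘ ((⟦ χ ⟧₁ ⊗₁ id) ∘ (α⇐ ∘ ((h ⊗₁ id) ∘ ((id ⊗₁ ⟦ θ ⟧₁) ∘ ⟦ φ ⟧₁))))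
      ≈⟨ refl⟩∘⟨ refl⟩∘⟨ extendˡ (square⁻¹ α-isoʳ α-isoˡ (≈-sym α-natural₁)) ⟨
    (k ⊗₁ m) ∘ ((⟦ χ ⟧₁ ⊗₁ id) ∘ (((h ⊗₁ id) ⊗₁ id) ∘ (α⇐ ∘ ((id ⊗₁ ⟦ θ ⟧₁) ∘ ⟦ φ ⟧₁))))
      ≈⟨ refl⟩∘⟨ pullˡ ⊗id-∘ ⟩
    (k ⊗₁ m) ∘ (((⟦ χ ⟧₁ ∘ (h ⊗₁ id)) ⊗₁ id) ∘ (α⇐ ∘ ((id ⊗₁ ⟦ θ ⟧₁) ∘ ⟦ φ ⟧₁)))
      ≈⟨ pullˡ (≈-trans (≈-sym ⊗-∘) (≈-refl ⇉ identityʳ)) ⟩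
    ((k ∘ (⟦ χ ⟧₁ ∘ (h ⊗₁ id))) ⊗₁ m) ∘ (α⇐ ∘ ((id ⊗₁ ⟦ θ ⟧₁) ∘ ⟦ φ ⟧₁))  ∎

  push-right : Linear (V ⊙ T₂) → (φ : T ⟿ T₁ ⊙ T₂) (ψ : V ⊙ T₂ ⟿ T₃ ⊙ T₄) → Disjoint V T₃ →
               ∃ λ W → Σ (V ⊙ W ⟿ T₄) λ χ → Σ (T ⟿ T₃ ⊙ (T₁ ⊙ W)) λ ω →
               ∀ {X Y} {h : ⟦ T₁ ⟧₀ ⇒ ⟦ V ⟧₀} {k : ⟦ T₃ ⟧₀ ⇒ X} {m : ⟦ T₄ ⟧₀ ⇒ Y} →
               ((k ⊗₁ m) ∘ ⟦ ψ ⟧₁) ∘ ((h ⊗₁ id) ∘ ⟦ φ ⟧₁) ≈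
               (k ⊗₁ (m ∘ (⟦ χ ⟧₁ ∘ (h ⊗₁ id)))) ∘ ⟦ ω ⟧₁
  push-right l φ ψ p =
    -- Exchanging the two halves reduces this to `push-left`; a second `γₛ` restores the order.
    let (W , χ , ω , eq) = push-left l φ (γₛ ∘ₛ ψ) p
    in W , χ , γₛ ∘ₛ ω , λ {X} {Y} {h} {k} {m} → begin
    ((k ⊗₁ m) ∘ ⟦ ψ ⟧₁) ∘ ((h ⊗₁ id) ∘ ⟦ φ ⟧₁)
      ≈⟨ (refl⟩∘⟨ ≈-sym (cancelˡ symmetry)) ⟩∘⟨refl ⟩
    ((k ⊗₁ m) ∘ (γ ∘ (γ ∘ ⟦ ψ ⟧₁))) ∘ ((h ⊗₁ id) ∘ ⟦ φ ⟧₁)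
      ≈⟨ ≈-trans (extendˡ (≈-sym γ-natural) ⟩∘⟨refl) assoc ⟩
    γ ∘ (((m ⊗₁ k) ∘ (γ ∘ ⟦ ψ ⟧₁)) ∘ ((h ⊗₁ id) ∘ ⟦ φ ⟧₁))
      ≈⟨ refl⟩∘⟨ eq ⟩
    γ ∘ (((m ∘ (⟦ χ ⟧₁ ∘ (h ⊗₁ id))) ⊗₁ k) ∘ ⟦ ω ⟧₁)
      ≈⟨ extendˡ γ-natural ⟩
    (k ⊗₁ (m ∘ (⟦ χ ⟧₁ ∘ (h ⊗₁ id)))) ∘ (γ ∘ ⟦ ω ⟧₁)  ∎

  -- A variable of `T₂` would be sent into `V`, against linearity. The η-rules depend on this: their
  -- body returns just the variables bound, so nothing else is left in its context.
  absorb : Linear (V ⊙ T₂) → (χ : V ⊙ T₂ ⟿ V) → T₂ ⟿ unit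
  absorb {T₂ = T₂} (_ , _ , p) χ = empty⟿unit T₂ (λ i → p (move χ (right i)) i)

  absorb-≈ : (l : Linear (V ⊙ T₂)) (χ : V ⊙ T₂ ⟿ V) (φ : T ⟿ T₁ ⊙ T₂)
             {h : ⟦ T₁ ⟧₀ ⇒ ⟦ V ⟧₀} →
             ⟦ χ ⟧₁ ∘ ((h ⊗₁ id) ∘ ⟦ φ ⟧₁) ≈ h ∘ ⟦ ρₛ ∘ₛ ((idₛ ⊗ₛ absorb l χ) ∘ₛ φ) ⟧₁
  absorb-≈ l χ φ {h} = begin
    ⟦ χ ⟧₁ ∘ ((h ⊗₁ id) ∘ ⟦ φ ⟧₁)
      ≈⟨ coherence (proj₁ l) χ (ρₛ ∘ₛ (idₛ ⊗ₛ absorb l χ)) ⟩∘⟨refl ⟩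
    (ρ⇒ ∘ (id ⊗₁ ⟦ absorb l χ ⟧₁)) ∘ ((h ⊗₁ id) ∘ ⟦ φ ⟧₁)
      ≈⟨ ≈-trans assoc (refl⟩∘⟨ extendˡ (≈-sym interchange)) ⟩
    ρ⇒ ∘ ((h ⊗₁ id) ∘ ((id ⊗₁ ⟦ absorb l χ ⟧₁) ∘ ⟦ φ ⟧₁))
      ≈⟨ extendˡ ρ-natural ⟩
    h ∘ (ρ⇒ ∘ ((id ⊗₁ ⟦ absorb l χ ⟧₁) ∘ ⟦ φ ⟧₁))  ∎

  disjoint-fv : Binds xs A V → xs # t → T ⊩ t ∶ B → Disjoint V T
  disjoint-fv b p d i j = All.lookup p (∈-binds b i) (∈⇒fv d j)

  Sound : ∀ {T t A} → T ⊩ t ∶ A → Term → Set e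
  Sound {T} {t} {A} d t′ = Σ (T ⊩ t′ ∶ A) λ d′ → ⟦ d ⟧ᵈ ≈ ⟦ d′ ⟧ᵈ

  inner-let : ∀ {P} (b : Binds (vars P) A V) (l : Linear (V ⊙ T₂)) (χ : V ⊙ T₂ ⟿ T₃)
              (d : T₁ ⊩ s ∶ A) (d′ : T₃ ⊩ t ∶ B) →
              ⟦ letᵖ {P = P} b l idₛ d (reshape χ d′) ⟧ᵈ ≈
              ⟦ d′ ⟧ᵈ ∘ (⟦ χ ⟧₁ ∘ ((unpack b ∘ ⟦ d ⟧ᵈ) ⊗₁ id))
  inner-let b l χ d d′ = ≈-trans (reshape-≈ χ d′ ⟩∘⟨ identityʳ) assoc

  sound-pairˡ : ∀ P → vars P # u → (d : T ⊩ letᵖ[ P ≔ s ] pair t u ∶ A) →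
                Sound d (pair (letᵖ[ P ≔ s ] t) u)
  sound-pairˡ P fresh (letᵖ b l φ s (pair ψ t u)) =
    let (W , χ , ω , eq) = push-left l φ ψ (disjoint-fv b fresh u)
        lW = move-linear (χ ⁻¹) (linearˡ ψ l)
    in pair ω (letᵖ {P = P} b lW idₛ s (reshape χ t)) u ,
       ≈-trans eq ((≈-sym (inner-let {P = P} b lW χ s t) ⇉ ≈-refl) ⟩∘⟨refl)

  sound-pairʳ : ∀ P → vars P # t → (d : T ⊩ letᵖ[ P ≔ s ] pair t u ∶ A) →
                Sound d (pair t (letᵖ[ P ≔ s ] u))
  sound-pairʳ P fresh (letᵖ b l φ s (pair ψ t u)) =
    let (W , χ , ω , eq) = push-right l φ ψ (disjoint-fv b fresh t)
        lW = move-linear (χ ⁻¹) (linearʳ ψ l)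
    in pair ω t (letᵖ {P = P} b lW idₛ s (reshape χ u)) ,
       ≈-trans eq ((≈-refl ⇉ ≈-sym (inner-let {P = P} b lW χ s u)) ⟩∘⟨refl)

  fv*-lookup : ∀ {n} (ts : Vec Term n) → x ∈fv* ts → ∃ λ j → x ∈fv lookup ts j
  fv*-lookup (t ∷ ts) (inj₁ p) = zero , p
  fv*-lookup (t ∷ ts) (inj₂ p) = let (j , q) = fv*-lookup ts p in suc j , q

  -- The `let` passes the arguments before `i` one at a time by `push-right`, each time landing
  -- directly in front of the remaining arguments, and enters argument `i` by `push-left`.
  sound-args : ∀ P {n} {ts : Vec Term n} {qs} (i : Fin n) →
               (∀ j → j ≢ i → vars P # lookup ts j) →
               (b : Binds (vars P) A V) → Linear (V ⊙ T₂) → (φ : T ⟿ T₁ ⊙ T₂)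
               (d : T₁ ⊩ s ∶ A) (ds : V ⊙ T₂ ⊩* ts ∶ qs) →
               Σ (T ⊩* ts [ i ]≔ (letᵖ[ P ≔ s ] lookup ts i) ∶ qs) λ ds′ →
               ⟦ ds ⟧ᵈ* ∘ (((unpack b ∘ ⟦ d ⟧ᵈ) ⊗₁ id) ∘ ⟦ φ ⟧₁) ≈ ⟦ ds′ ⟧ᵈ*
  sound-args P {ts = t ∷ ts} zero fresh b l φ d (cons* ψ t′ ts′) =
    let (W , χ , ω , eq) = push-left l φ ψ λ i j →
          let (k , p) = fv*-lookup ts (∈⇒fv* ts′ j)
          in All.lookup (fresh (suc k) λ ()) (∈-binds b i) p
        lW = move-linear (χ ⁻¹) (linearˡ ψ l)
    in cons* ω (letᵖ {P = P} b lW idₛ d (reshape χ t′)) ts′ ,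
       ≈-trans assoc (refl⟩∘⟨ ≈-trans eq
         ((≈-sym (inner-let {P = P} b lW χ d t′) ⇉ ≈-refl) ⟩∘⟨refl))
  sound-args P {ts = t ∷ ts} (suc i) fresh b l φ d (cons* ψ t′ ts′) =
    let (W , χ , ω , eq) = push-right l φ ψ (disjoint-fv b (fresh zero λ ()) t′)
        lW = move-linear (χ ⁻¹) (linearʳ ψ l)
        (ds , eq′) = sound-args P i (λ j ne → fresh (suc j) λ { refl → ne refl })
                       b lW idₛ d (reshape* χ ts′)
    in cons* ω t′ ds , ≈-trans assoc (refl⟩∘⟨ ≈-trans eq ((≈-refl ⇉ (begin
         ⟦ ts′ ⟧ᵈ* ∘ (⟦ χ ⟧₁ ∘ ((unpack b ∘ ⟦ d ⟧ᵈ) ⊗₁ id))        ≈⟨ pullˡ (≈-sym (reshape*-≈ χ ts′)) ⟩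
         ⟦ reshape* χ ts′ ⟧ᵈ* ∘ ((unpack b ∘ ⟦ d ⟧ᵈ) ⊗₁ id)        ≈⟨ refl⟩∘⟨ identityʳ ⟨
         ⟦ reshape* χ ts′ ⟧ᵈ* ∘ (((unpack b ∘ ⟦ d ⟧ᵈ) ⊗₁ id) ∘ id) ≈⟨ eq′ ⟩
         ⟦ ds ⟧ᵈ*                                                  ∎)) ⟩∘⟨refl))

  sound-nest : ∀ P R → (∀ z → z ∈ᴸ vars P → z ∈fv u → z ∈ᴸ vars R) →
               (d : T ⊩ letᵖ[ P ≔ s ] letᵖ[ R ≔ t ] u ∶ A) →
               Sound d (letᵖ[ R ≔ (letᵖ[ P ≔ s ] t) ] u)
  sound-nest P R fresh (letᵖ b l φ s (letᵖ b′ l′ ψ t u)) =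
    -- A variable of `P` in the context left over for `u` would be free in `u`, hence bound by `R`,
    -- and the linear context of `u` excludes that.
    let (W , χ , ω , eq) = push-left l φ ψ λ i j →
          ∉-bound b′ l′ j (fresh _ (∈-binds b i) (∈⇒fv u (right j)))
        lW = move-linear (χ ⁻¹) (linearˡ ψ l)
    in letᵖ {P = R} b′ l′ ω (letᵖ {P = P} b lW idₛ s (reshape χ t)) u ,
       ≈-trans assoc (refl⟩∘⟨ ≈-trans eq
         ((≈-trans assoc (refl⟩∘⟨ ≈-sym (inner-let {P = P} b lW χ s t)) ⇉ ≈-refl) ⟩∘⟨refl))

  sound-exch : ∀ P R → vars P # t → vars R # s → Linear T →
               (d : T ⊩ letᵖ[ P ≔ s ] letᵖ[ R ≔ t ] u ∶ A) →
               Sound d (letᵖ[ R ≔ t ] letᵖ[ P ≔ s ] u)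
  sound-exch P R freshP freshR lT (letᵖ {V = V} {T₁ = T₁} b l φ s (letᵖ {V = V′} {T₂ = T₄} b′ l′ ψ t u)) =
    let (W , χ , ω , eq) = push-right l φ ψ (disjoint-fv b freshP t)
        -- With `P` now bound last, its variables stand in front; `ζ` brings those of `R` back to
        -- the front, where `u` expects them.
        ζ : V ⊙ (V′ ⊙ W) ⟿ V′ ⊙ T₄
        ζ = (idₛ ⊗ₛ χ) ∘ₛ σₛ
        l₁ : Linear (V′ ⊙ (T₁ ⊙ W))
        l₁ = proj₁ l′ , linearʳ ω lT , λ
          { i (left j)  → disjoint-fv b′ freshR s i j
          ; i (right j) → proj₂ (proj₂ l′) i (move χ (right j)) }
        l₂ = move-linear (ζ ⁻¹) l′
        h = unpack b ∘ ⟦ s ⟧ᵈ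
        k = unpack b′ ∘ ⟦ t ⟧ᵈ
    in letᵖ {P = R} b′ l₁ ω t (letᵖ {P = P} b l₂ σₛ s (reshape ζ u)) , (begin
    (⟦ u ⟧ᵈ ∘ ((k ⊗₁ id) ∘ ⟦ ψ ⟧₁)) ∘ ((h ⊗₁ id) ∘ ⟦ φ ⟧₁)
      ≈⟨ ≈-trans assoc (refl⟩∘⟨ eq) ⟩
    ⟦ u ⟧ᵈ ∘ ((k ⊗₁ (id ∘ (⟦ χ ⟧₁ ∘ (h ⊗₁ id)))) ∘ ⟦ ω ⟧₁)
      ≈⟨ refl⟩∘⟨ pushˡ (≈-trans (≈-refl ⇉ identityˡ) (≈-sym ⊗-second)) ⟩
    ⟦ u ⟧ᵈ ∘ ((id ⊗₁ (⟦ χ ⟧₁ ∘ (h ⊗₁ id))) ∘ ((k ⊗₁ id) ∘ ⟦ ω ⟧₁))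
      ≈⟨ refl⟩∘⟨ swapped ⟩∘⟨refl ⟩
    ⟦ u ⟧ᵈ ∘ ((((id ⊗₁ ⟦ χ ⟧₁) ∘ σ⇒) ∘ ((h ⊗₁ id) ∘ σ⇒)) ∘ ((k ⊗₁ id) ∘ ⟦ ω ⟧₁))
      ≈⟨ ≈-trans (≈-sym assoc) (≈-trans (≈-sym assoc) (≈-sym (reshape-≈ ζ u) ⟩∘⟨refl) ⟩∘⟨refl) ⟩
    (⟦ reshape ζ u ⟧ᵈ ∘ ((h ⊗₁ id) ∘ σ⇒)) ∘ ((k ⊗₁ id) ∘ ⟦ ω ⟧₁)  ∎)
    where
    -- By naturality of `σ⇒`, a box on the second factor is a box on the first factor conjugated by
    -- `σ⇒`.
    swapped : ∀ {X Y Z U K} {c : Y ⊗₀ Z ⇒ U} {h : X ⇒ Y} →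
              id {K} ⊗₁ (c ∘ (h ⊗₁ id)) ≈ ((id ⊗₁ c) ∘ σ⇒) ∘ ((h ⊗₁ id) ∘ σ⇒)
    swapped {c = c} {h} = begin
      id ⊗₁ (c ∘ (h ⊗₁ id))                        ≈⟨ id⊗-∘ ⟨
      (id ⊗₁ c) ∘ (id ⊗₁ (h ⊗₁ id))                ≈⟨ refl⟩∘⟨ cancelʳ σ-involutive ⟨
      (id ⊗₁ c) ∘ (((id ⊗₁ (h ⊗₁ id)) ∘ σ⇒) ∘ σ⇒)  ≈⟨ refl⟩∘⟨ ≈-sym σ-natural ⟩∘⟨refl ⟩
      (id ⊗₁ c) ∘ ((σ⇒ ∘ (h ⊗₁ (id ⊗₁ id))) ∘ σ⇒)
        ≈⟨ refl⟩∘⟨ ≈-trans assoc (refl⟩∘⟨ (≈-refl ⇉ ⊗-id) ⟩∘⟨refl) ⟩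
      (id ⊗₁ c) ∘ (σ⇒ ∘ ((h ⊗₁ id) ∘ σ⇒))          ≈⟨ assoc ⟨
      ((id ⊗₁ c) ∘ σ⇒) ∘ ((h ⊗₁ id) ∘ σ⇒)          ∎

  sound-gate : ∀ P g (i : Fin (arity g)) {ts} → (∀ j → j ≢ i → vars P # lookup ts j) →
               (d : T ⊩ letᵖ[ P ≔ s ] gate g ts ∶ A) →
               Sound d (gate g (ts [ i ]≔ (letᵖ[ P ≔ s ] lookup ts i)))
  sound-gate P g i fresh (letᵖ b l φ s (gate .g ts)) =
    let (ts′ , eq) = sound-args P i fresh b l φ s ts
    in gate g ts′ , ≈-trans assoc₂ (refl⟩∘⟨ refl⟩∘⟨ eq)

  ≔-≡ : ∀ σ x s → (σ [ x ↦ s ]) x ≡ s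
  ≔-≡ σ x s = cong (if_then s else σ x) (dec-true (x ≟ x) refl)

  ≔-≢ : ∀ σ s → z ≢ x → (σ [ x ↦ s ]) z ≡ σ z
  ≔-≢ {z} {x} σ s n = cong (if_then s else σ z) (dec-false (z ≟ x) n)

  -- The split `φ` of the `let` itself serves as the substitution, with `s` for the bound leaf and
  -- identities on the rest. Its meaning is the map that the `let` composes with its body.
  sound-β-let : NoCapture (var [ x ↦ s ]) t → Linear T →
                (d : T ⊩ let[ x ≔ s ] t ∶ A) → Sound d (subst (var [ x ↦ s ]) t)
  sound-β-let {x} {s₀} nc l (let₁ one lV φ s t) =
    let τ = splitˢ φ (leafˢ (≔-≡ var x s₀) s) (identityˢ free)
        (d , eq) = substitute t τ l nc
    in d , ≈-trans (refl⟩∘⟨ ((identityˡ ⇉ ≈-sym (identityˢ-≈ free)) ⟩∘⟨refl)) (≈-sym eq)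
    where
    free : ∀ {z A} → z ∶ A ∈ _ → (var [ x ↦ s₀ ]) z ≡ var z
    free i = ≔-≢ var s₀ λ { refl → proj₂ (proj₂ lV) here i }

  bound-distinct : Linear ((leaf x A ⊙ leaf y B) ⊙ T) → x ≢ y
  bound-distinct ((_ , _ , p) , _) refl = p here here

  -- The later update, for `y`, shadows the one for `x`; distinctness ensures that `x` still
  -- receives its own term.
  two-≡₁ : ∀ s t → x ≢ y → (var [ x ↦ s ] [ y ↦ t ]) x ≡ s
  two-≡₁ {x} {y} s t n = trans (≔-≢ (var [ x ↦ s ]) t n) (≔-≡ var x s)

  two-free : Linear ((leaf x A ⊙ leaf y B) ⊙ T) → ∀ s t → z ∶ D ∈ T →
             (var [ x ↦ s ] [ y ↦ t ]) z ≡ var z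
  two-free {x} (_ , _ , p) s t i =
    trans (≔-≢ (var [ x ↦ s ]) t λ { refl → p (right here) i })
          (≔-≢ var s λ { refl → p (left here) i })

  sound-β-⊗ : NoCapture (var [ x ↦ s ] [ y ↦ t ]) u → Linear T →
              (d : T ⊩ letᵖ[ x , y ≔ pair s t ] u ∶ A) →
              Sound d (subst (var [ x ↦ s ] [ y ↦ t ]) u)
  sound-β-⊗ {x} {s₀} {y} {t₀} nc l (letᵖ two lV φ (pair ψ s t) u) =
    let τ = splitˢ φ (splitˢ ψ (leafˢ (two-≡₁ s₀ t₀ (bound-distinct lV)) s)
                            (leafˢ (≔-≡ (var [ x ↦ s₀ ]) y t₀) t))
                  (identityˢ (two-free lV s₀ t₀))
        (d , eq) = substitute u τ l nc
    in d , ≈-trans (refl⟩∘⟨ ((identityˡ ⇉ ≈-sym (identityˢ-≈ (two-free lV s₀ t₀))) ⟩∘⟨refl)) (≈-sym eq)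

  sound-η-𝟙 : (d : T ⊩ letᵖ[ ✶ ≔ t ] ✶ ∶ A) → Sound d t
  sound-η-𝟙 (letᵖ none l φ t (✶ χ)) =
    let ω = ρₛ ∘ₛ ((idₛ ⊗ₛ absorb l χ) ∘ₛ φ)
    in reshape ω t , ≈-trans (absorb-≈ l χ φ) (≈-trans (identityˡ ⟩∘⟨refl) (≈-sym (reshape-≈ ω t)))

  sound-η-⊗ : (d : T ⊩ letᵖ[ x , y ≔ t ] pair (var x) (var y) ∶ A) → Sound d t
  sound-η-⊗ (letᵖ two l φ t (pair ψ (var θ) (var θ′)))
    -- The pair is typed by whichever leaves named `x` and `y` it reaches; linearity gives them the
    -- types just bound, so that `χ` ends in `V`.
    with refl ← type-unique l (left (left here)) (move (ψ ⁻¹) (left (move (θ ⁻¹) here)))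
       | refl ← type-unique l (left (right here)) (move (ψ ⁻¹) (right (move (θ′ ⁻¹) here))) =
    let χ = (θ ⊗ₛ θ′) ∘ₛ ψ
        ω = ρₛ ∘ₛ ((idₛ ⊗ₛ absorb l χ) ∘ₛ φ)
    in reshape ω t , ≈-trans (absorb-≈ l χ φ) (≈-trans (identityˡ ⟩∘⟨refl) (≈-sym (reshape-≈ ω t)))

  sound-β-𝟙 : (d : T ⊩ letᵖ[ ✶ ≔ ✶ ] t ∶ A) → Sound d t
  sound-β-𝟙 (letᵖ none l φ (✶ ω) t) =
    let θ = (ω ⊗ₛ idₛ) ∘ₛ φ
    in reshape θ t , ≈-trans (refl⟩∘⟨ (identityˡ ⇉ ≈-refl) ⟩∘⟨refl) (≈-sym (reshape-≈ θ t))

  sound-α-let : (x′ ∈fv t → x′ ≡ x) → NoCapture (var [ x ↦ var x′ ]) t →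
                (d : T ⊩ let[ x ≔ s ] t ∶ A) →
                Sound d (let[ x′ ≔ s ] subst (var [ x ↦ var x′ ]) t)
  sound-α-let {x′ = x′} {x = x} fresh nc (let₁ {T₂ = T₂} one l φ s t) =
    let l′ = tt , proj₁ (proj₂ l) , λ { here i → unused i }
        τ = splitˢ idₛ (leafˢ (≔-≡ var x (var x′)) (var idₛ)) (identityˢ free)
        (d , eq) = substitute t τ l′ nc
    in let₁ one l′ φ s d , (≈-sym (≈-trans eq (≈-trans (refl⟩∘⟨ ≈-trans identityʳ
         (≈-trans (≈-refl ⇉ identityˢ-≈ free) ⊗-id)) identityʳ)) ⟩∘⟨refl)
    where
    unused : ∀ {A} → x′ ∶ A ∈ T₂ → ⊥
    unused i with refl ← fresh (∈⇒fv t (right i)) = proj₂ (proj₂ l) here i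
    free : ∀ {z A} → z ∶ A ∈ T₂ → (var [ x ↦ var x′ ]) z ≡ var z
    free i = ≔-≢ var (var x′) λ { refl → proj₂ (proj₂ l) here i }

  sound-α-let⊗ : x′ ≢ y′ → (∀ z → z ∈ᴸ x′ ∷ y′ ∷ [] → z ∈fv t → z ∈ᴸ x ∷ y ∷ []) →
                 NoCapture (var [ x ↦ var x′ ] [ y ↦ var y′ ]) t →
                 (d : T ⊩ letᵖ[ x , y ≔ s ] t ∶ A) →
                 Sound d (letᵖ[ x′ , y′ ≔ s ] subst (var [ x ↦ var x′ ] [ y ↦ var y′ ]) t)
  sound-α-let⊗ {x′ = x′} {y′ = y′} {x = x} {y = y} n fresh nc (letᵖ {T₂ = T₂} two l φ s t) =
    let l′ = (tt , tt , λ { here here → n refl }) , proj₁ (proj₂ l) , λ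
          { (left here)  i → unused (here refl) i
          ; (right here) i → unused (there (here refl)) i }
        τ = splitˢ idₛ (splitˢ idₛ (leafˢ (two-≡₁ (var x′) (var y′) (bound-distinct l)) (var idₛ))
                                 (leafˢ (≔-≡ (var [ x ↦ var x′ ]) y (var y′)) (var idₛ)))
                  (identityˢ free)
        (d , eq) = substitute t τ l′ nc
    in letᵖ {P = x′ , y′} two l′ φ s d , (≈-sym (≈-trans eq (≈-trans (refl⟩∘⟨ ≈-trans identityʳ
         (≈-trans (≈-trans identityʳ ⊗-id ⇉ identityˢ-≈ free) ⊗-id)) identityʳ)) ⟩∘⟨refl)
    where
    free : ∀ {z A} → z ∶ A ∈ T₂ → (var [ x ↦ var x′ ] [ y ↦ var y′ ]) z ≡ var z
    free = two-free l (var x′) (var y′)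
    unused : ∀ {z A} → z ∈ᴸ x′ ∷ y′ ∷ [] → z ∶ A ∈ T₂ → ⊥
    unused p i = ∉-bound two l i (fresh _ p (∈⇒fv t (right i)))

  two-distinct : T ⊩ letᵖ[ x , y ≔ s ] t ∶ A → x ≢ y
  two-distinct (letᵖ two l φ s t) = bound-distinct l

  axiom-sound : Linear T → (d : T ⊩ s ∶ A) (d′ : T ⊩ t ∶ A) → s ↝ t → ⟦ d ⟧ᵈ ≈ ⟦ d′ ⟧ᵈ
  axiom-sound {T} l d d′ r = let (e , p) = sound d d′ r in ≈-trans p (⊩-coherence l e d′)
    where
    sound : ∀ {s t A} (d : T ⊩ s ∶ A) → T ⊩ t ∶ A → s ↝ t → Sound d t
    -- The side conditions of the renaming do not separate `x′` from `y′`; the typing `d′` of the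
    -- right-hand side does.
    sound d d′ (α-let⊗ fresh nc)          = sound-α-let⊗ (two-distinct d′) fresh nc d
    sound d d′ (α-let fresh nc)           = sound-α-let fresh nc d
    sound d d′ β-𝟙                        = sound-β-𝟙 d
    sound d d′ (β-⊗ nc)                   = sound-β-⊗ nc l d
    sound d d′ (β-let nc)                 = sound-β-let nc l d
    sound d d′ η-𝟙                        = sound-η-𝟙 d
    sound d d′ η-⊗                        = sound-η-⊗ d
    sound d d′ (cc-nest P R fresh)        = sound-nest P R fresh d
    sound d d′ (cc-exch P R _ p q)        = sound-exch P R p q l d
    sound d d′ (cc-gate P g i fresh)      = sound-gate P g i fresh d
    sound d d′ (cc-pairˡ P fresh)         = sound-pairˡ P fresh d
    sound d d′ (cc-pairʳ P fresh)         = sound-pairʳ P fresh d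

-- Judgemental equality

module Soundness {o ℓ e} (S : Signature) (M : Model S o ℓ e) where
  open Signature S
  open Language S hiding (_∖_)
  open Model M using (⟦_⟧; ⟦_⟧*; ⟦_⟧ᶜ; split; exchange)
  open Axioms S M
  open ≈-Reasoning

  private variable
    x : Var
    A B : Ty
    Γ Δ : Ctx
    s t : Term

  tree : Ctx → Tree
  tree []            = unit
  tree ((x , A) ∷ Γ) = leaf x A ⊙ tree Γ

  -- The identity, written by recursion because the two objects agree only after `Γ` is inspected.
  embed : ∀ Γ → ⟦ Γ ⟧ᶜ ⇒ ⟦ tree Γ ⟧₀
  embed []      = id
  embed (_ ∷ Γ) = id ⊗₁ embed Γ

  splitₛ : ∀ Γ → tree (Γ ++ Δ) ⟿ tree Γ ⊙ tree Δ
  splitₛ []      = λₛ⁻¹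
  splitₛ (_ ∷ Γ) = αₛ⁻¹ ∘ₛ (idₛ ⊗ₛ splitₛ Γ)

  embed-split : ∀ Γ → ⟦ splitₛ {Δ} Γ ⟧₁ ∘ embed (Γ ++ Δ) ≈ (embed Γ ⊗₁ embed Δ) ∘ split Γ
  embed-split []      = ≈-sym (square⁻¹ λ-isoʳ λ-isoˡ (≈-sym λ-natural))
  embed-split {Δ} (_ ∷ Γ) = begin
    (α⇐ ∘ (id ⊗₁ ⟦ splitₛ Γ ⟧₁)) ∘ (id ⊗₁ embed (Γ ++ Δ))  ≈⟨ assoc ⟩
    α⇐ ∘ ((id ⊗₁ ⟦ splitₛ Γ ⟧₁) ∘ (id ⊗₁ embed (Γ ++ Δ)))
      ≈⟨ refl⟩∘⟨ ≈-trans id⊗-∘ (≈-trans (≈-refl ⇉ embed-split Γ) (≈-sym id⊗-∘)) ⟩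
    α⇐ ∘ ((id ⊗₁ (embed Γ ⊗₁ embed Δ)) ∘ (id ⊗₁ split Γ))
      ≈⟨ extendˡ (square⁻¹ α-isoʳ α-isoˡ (≈-sym α-natural)) ⟨
    ((id ⊗₁ embed Γ) ⊗₁ embed Δ) ∘ (α⇐ ∘ (id ⊗₁ split Γ))  ∎

  exchangeₛ : ∀ Γ {x y A B} → tree (Γ ++ (y , B) ∷ (x , A) ∷ Δ) ⟿ tree (Γ ++ (x , A) ∷ (y , B) ∷ Δ)
  exchangeₛ []      = σₛ
  exchangeₛ (_ ∷ Γ) = idₛ ⊗ₛ exchangeₛ Γ

  embed-exchange : ∀ Γ {x y A B} →
    ⟦ exchangeₛ {Δ} Γ {x} {y} {A} {B} ⟧₁ ∘ embed (Γ ++ (y , B) ∷ (x , A) ∷ Δ) ≈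
    embed (Γ ++ (x , A) ∷ (y , B) ∷ Δ) ∘ exchange Γ
  embed-exchange []      = σ-natural
  embed-exchange (_ ∷ Γ) = ≈-trans id⊗-∘ (≈-trans (≈-refl ⇉ embed-exchange Γ) (≈-sym id⊗-∘))

  tree-fresh : ∀ Γ → All (x ≢_) (map proj₁ Γ) → x ∶ A ∈ tree Γ → ⊥
  tree-fresh (_ ∷ Γ) (n ∷ ns) (left here) = n refl
  tree-fresh (_ ∷ Γ) (n ∷ ns) (right i)   = tree-fresh Γ ns i

  distinct⇒linear : ∀ Γ → Distinct Γ → Linear (tree Γ)
  distinct⇒linear []      []       = tt
  distinct⇒linear (_ ∷ Γ) (n ∷ ns) = tt , distinct⇒linear Γ ns , λ { here i → tree-fresh Γ n i }

  ⊢-linear : Γ ⊢ t ∶ A → Linear (tree Γ)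
  ⊢-linear (swap Γ d)    = move-linear (exchangeₛ Γ ⁻¹) (⊢-linear d)
  ⊢-linear var           = tt , tt , λ _ ()
  ⊢-linear unitI         = tt
  ⊢-linear (unitE u _ _) = distinct⇒linear _ u
  ⊢-linear (gate _ u _)  = distinct⇒linear _ u
  ⊢-linear (tensI u _ _) = distinct⇒linear _ u
  ⊢-linear (tensE u _ _) = distinct⇒linear _ u
  ⊢-linear (letE u _ _)  = distinct⇒linear _ u

  translate  : Γ ⊢ t ∶ A → tree Γ ⊩ t ∶ A
  translate* : ∀ {n} {ts : Vec Term n} {qs} → Γ ⊢* ts ∶ qs → tree Γ ⊩* ts ∶ qs
  translate (swap Γ d)                = reshape (exchangeₛ Γ) (translate d)
  translate var                       = var ρₛ
  translate unitI                     = ✶ idₛ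
  -- The variables of a pattern form one tree in front of the remaining context, so the body gains a
  -- `unit` here and is rebracketed for `tensE`.
  translate (unitE {Γ = Γ} _ d d′)    = letᵖ {P = ✶} none (move-linear λₛ⁻¹ (⊢-linear d′))
    (splitₛ Γ) (translate d) (reshape λₛ (translate d′))
  translate (gate g _ ds)             = gate g (translate* ds)
  translate (tensI {Γ = Γ} _ d d′)    = pair (splitₛ Γ) (translate d) (translate d′)
  translate (tensE {Γ = Γ} {x = x} {y} _ d d′) = letᵖ {P = x , y} two (move-linear αₛ⁻¹ (⊢-linear d′))
    (splitₛ Γ) (translate d) (reshape αₛ (translate d′))
  translate (letE {Γ = Γ} _ d d′)     = let₁ one (⊢-linear d′) (splitₛ Γ) (translate d) (translate d′)
  translate* []                       = nil* idₛ
  translate* (_∷_ {Γ = Γ} d ds)       = cons* (splitₛ Γ) (translate d) (translate* ds)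

  embed-pair : ∀ Γ {X Y} {h : ⟦ Γ ⟧ᶜ ⇒ X} {k : ⟦ Δ ⟧ᶜ ⇒ Y} {h′ : ⟦ tree Γ ⟧₀ ⇒ X} {k′ : ⟦ tree Δ ⟧₀ ⇒ Y} →
    h ≈ h′ ∘ embed Γ → k ≈ k′ ∘ embed Δ →
    (h ⊗₁ k) ∘ split Γ ≈ ((h′ ⊗₁ k′) ∘ ⟦ splitₛ {Δ} Γ ⟧₁) ∘ embed (Γ ++ Δ)
  embed-pair {Δ} Γ {h = h} {k} {h′} {k′} p q = begin
    (h ⊗₁ k) ∘ split Γ                                     ≈⟨ pushˡ (≈-trans (p ⇉ q) ⊗-∘) ⟩
    (h′ ⊗₁ k′) ∘ ((embed Γ ⊗₁ embed Δ) ∘ split Γ)          ≈⟨ refl⟩∘⟨ embed-split Γ ⟨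
    (h′ ⊗₁ k′) ∘ (⟦ splitₛ Γ ⟧₁ ∘ embed (Γ ++ Δ))          ≈⟨ assoc ⟨
    ((h′ ⊗₁ k′) ∘ ⟦ splitₛ Γ ⟧₁) ∘ embed (Γ ++ Δ)          ∎

  embed-let : ∀ Γ {X Y} {h : ⟦ Γ ⟧ᶜ ⇒ X} {h′ : ⟦ tree Γ ⟧₀ ⇒ X}
    {k : X ⊗₀ ⟦ Δ ⟧ᶜ ⇒ Y} {k′ : X ⊗₀ ⟦ tree Δ ⟧₀ ⇒ Y} →
    h ≈ h′ ∘ embed Γ → k ≈ k′ ∘ (id ⊗₁ embed Δ) →
    k ∘ ((h ⊗₁ id) ∘ split Γ) ≈ (k′ ∘ (((id ∘ h′) ⊗₁ id) ∘ ⟦ splitₛ {Δ} Γ ⟧₁)) ∘ embed (Γ ++ Δ)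
  embed-let {Δ} Γ {h = h} {h′} {k} {k′} p q = begin
    k ∘ ((h ⊗₁ id) ∘ split Γ)                                            ≈⟨ pushˡ q ⟩
    k′ ∘ ((id ⊗₁ embed Δ) ∘ ((h ⊗₁ id) ∘ split Γ))                       ≈⟨ refl⟩∘⟨ pullˡ ⊗-second ⟩
    k′ ∘ ((h ⊗₁ embed Δ) ∘ split Γ)
      ≈⟨ refl⟩∘⟨ embed-pair Γ (≈-trans p (≈-sym identityˡ ⟩∘⟨refl)) (≈-sym identityˡ) ⟩
    k′ ∘ ((((id ∘ h′) ⊗₁ id) ∘ ⟦ splitₛ Γ ⟧₁) ∘ embed (Γ ++ Δ))          ≈⟨ assoc ⟨
    (k′ ∘ (((id ∘ h′) ⊗₁ id) ∘ ⟦ splitₛ Γ ⟧₁)) ∘ embed (Γ ++ Δ)          ∎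

  translate-≈  : (d : Γ ⊢ t ∶ A) → ⟦ d ⟧ ≈ ⟦ translate d ⟧ᵈ ∘ embed Γ
  translate*-≈ : ∀ {n} {ts : Vec Term n} {qs} (ds : Γ ⊢* ts ∶ qs) →
                 ⟦ ds ⟧* ≈ ⟦ translate* ds ⟧ᵈ* ∘ embed Γ
  translate-≈ (swap Γ d) = ≈-trans (pushˡ (translate-≈ d))
    (≈-trans (refl⟩∘⟨ ≈-sym (embed-exchange Γ)) (pullˡ (≈-sym (reshape-≈ (exchangeₛ Γ) (translate d)))))
  translate-≈ var = ≈-sym (≈-trans (refl⟩∘⟨ ⊗-id) identityʳ)
  translate-≈ unitI = ≈-sym identityˡ
  translate-≈ (unitE {Γ = Γ} {Δ} _ d d′) = begin
    -- Unit-E is interpreted as a tensor; sliding the body out through `λ⇒` gives the composite form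
    -- of a `let`.
    λ⇒ ∘ ((⟦ d ⟧ ⊗₁ ⟦ d′ ⟧) ∘ split Γ)                  ≈⟨ refl⟩∘⟨ pushˡ (≈-sym ⊗-second) ⟩
    λ⇒ ∘ ((id ⊗₁ ⟦ d′ ⟧) ∘ ((⟦ d ⟧ ⊗₁ id) ∘ split Γ))   ≈⟨ extendˡ λ-natural ⟩
    ⟦ d′ ⟧ ∘ (λ⇒ ∘ ((⟦ d ⟧ ⊗₁ id) ∘ split Γ))           ≈⟨ assoc ⟨
    (⟦ d′ ⟧ ∘ λ⇒) ∘ ((⟦ d ⟧ ⊗₁ id) ∘ split Γ)           ≈⟨ embed-let Γ (translate-≈ d) (begin
      ⟦ d′ ⟧ ∘ λ⇒                                       ≈⟨ pushˡ (translate-≈ d′) ⟩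
      ⟦ translate d′ ⟧ᵈ ∘ (embed Δ ∘ λ⇒)                ≈⟨ refl⟩∘⟨ λ-natural ⟨
      ⟦ translate d′ ⟧ᵈ ∘ (λ⇒ ∘ (id ⊗₁ embed Δ))        ≈⟨ pullˡ (≈-sym (reshape-≈ λₛ (translate d′))) ⟩
      ⟦ reshape λₛ (translate d′) ⟧ᵈ ∘ (id ⊗₁ embed Δ)  ∎) ⟩
    _                                                   ∎
  translate-≈ (gate g _ ds) = ≈-trans (refl⟩∘⟨ refl⟩∘⟨ translate*-≈ ds) (≈-sym assoc₂)
  translate-≈ (tensI {Γ = Γ} _ d d′) = embed-pair Γ (translate-≈ d) (translate-≈ d′)
  translate-≈ (tensE {Γ = Γ} {Δ} _ d d′) =
    ≈-trans (≈-sym assoc) (embed-let Γ (translate-≈ d) (begin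
      ⟦ d′ ⟧ ∘ α⇒                                                ≈⟨ pushˡ (translate-≈ d′) ⟩
      ⟦ translate d′ ⟧ᵈ ∘ ((id ⊗₁ (id ⊗₁ embed Δ)) ∘ α⇒)         ≈⟨ refl⟩∘⟨ α-natural₃ ⟨
      ⟦ translate d′ ⟧ᵈ ∘ (α⇒ ∘ (id ⊗₁ embed Δ))
        ≈⟨ pullˡ (≈-sym (reshape-≈ αₛ (translate d′))) ⟩
      ⟦ reshape αₛ (translate d′) ⟧ᵈ ∘ (id ⊗₁ embed Δ)           ∎))
  translate-≈ (letE {Γ = Γ} _ d d′) = embed-let Γ (translate-≈ d) (translate-≈ d′)
  translate*-≈ [] = ≈-sym identityˡ
  translate*-≈ (_∷_ {Γ = Γ} d ds) =
    ≈-trans (refl⟩∘⟨ embed-pair Γ (translate-≈ d) (translate*-≈ ds)) (≈-sym assoc)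

  ⊢-coherence : (d d′ : Γ ⊢ t ∶ A) → ⟦ d ⟧ ≈ ⟦ d′ ⟧
  ⊢-coherence d d′ = ≈-trans (translate-≈ d) (≈-trans
    (⊩-coherence (⊢-linear d) (translate d) (translate d′) ⟩∘⟨refl) (≈-sym (translate-≈ d′)))

  -- Exhibiting some derivations suits the induction: a congruence rule rebuilds them by the
  -- matching typing rule, whereas arbitrary derivations of its sides might end in swaps.
  ≐-sound : Γ ⊢ s ≐ t ∶ A → Σ (Γ ⊢ s ∶ A) λ d → Σ (Γ ⊢ t ∶ A) λ d′ → ⟦ d ⟧ ≈ ⟦ d′ ⟧
  ≐*-sound : ∀ {n} {ts ts′ : Vec Term n} {qs} → Γ ⊢* ts ≐ ts′ ∶ qs →
             Σ (Γ ⊢* ts ∶ qs) λ ds → Σ (Γ ⊢* ts′ ∶ qs) λ ds′ → ⟦ ds ⟧* ≈ ⟦ ds′ ⟧*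
  ≐-sound (axiom d d′ r) = d , d′ , ≈-trans (translate-≈ d) (≈-trans
    (axiom-sound (⊢-linear d) (translate d) (translate d′) r ⟩∘⟨refl) (≈-sym (translate-≈ d′)))
  ≐-sound (refl d) = d , d , ≈-refl
  ≐-sound (sym h) = let (d , d′ , p) = ≐-sound h in d′ , d , ≈-sym p
  ≐-sound (trans h k) =
    let (d , d₁ , p) = ≐-sound h
        (d₂ , d′ , q) = ≐-sound k
    -- Each premise supplies its own derivation of the middle term, and coherence joins the two.
    in d , d′ , ≈-trans p (≈-trans (⊢-coherence d₁ d₂) q)
  ≐-sound (swap Γ h) = let (d , d′ , p) = ≐-sound h in swap Γ d , swap Γ d′ , (p ⟩∘⟨refl)
  ≐-sound (unitE u h k) =
    let (d , d′ , p) = ≐-sound h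
        (c , c′ , q) = ≐-sound k
    in unitE u d c , unitE u d′ c′ , (refl⟩∘⟨ (p ⇉ q) ⟩∘⟨refl)
  ≐-sound (gate g u hs) =
    let (ds , ds′ , p) = ≐*-sound hs in gate g u ds , gate g u ds′ , (refl⟩∘⟨ refl⟩∘⟨ p)
  ≐-sound (tensI u h k) =
    let (d , d′ , p) = ≐-sound h
        (c , c′ , q) = ≐-sound k
    in tensI u d c , tensI u d′ c′ , ((p ⇉ q) ⟩∘⟨refl)
  ≐-sound (tensE u h k) =
    let (d , d′ , p) = ≐-sound h
        (c , c′ , q) = ≐-sound k
    in tensE u d c , tensE u d′ c′ , (q ⟩∘⟨ refl⟩∘⟨ (p ⇉ ≈-refl) ⟩∘⟨refl)
  ≐-sound (letE u h k) =
    let (d , d′ , p) = ≐-sound h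
        (c , c′ , q) = ≐-sound k
    in letE u d c , letE u d′ c′ , (q ⟩∘⟨ (p ⇉ ≈-refl) ⟩∘⟨refl)
  ≐*-sound [] = [] , [] , ≈-refl
  ≐*-sound (h ∷ hs) =
    let (d , d′ , p) = ≐-sound h
        (ds , ds′ , q) = ≐*-sound hs
    in d ∷ ds , d′ ∷ ds′ , (refl⟩∘⟨ (p ⇉ q) ⟩∘⟨refl)

proposition4 : ∀ {o ℓ e} (S : Signature) (M : Model S o ℓ e) →
    let open Language S
        open Model M
    in ∀ {Γ s t A} → Γ ⊢ s ≐ t ∶ A →
       (d : Γ ⊢ s ∶ A) (d′ : Γ ⊢ t ∶ A) → ⟦ d ⟧ ≈ ⟦ d′ ⟧
proposition4 S M h d d′ =
  let (d₁ , d₂ , p) = ≐-sound h in ≈-trans (⊢-coherence d d₁) (≈-trans p (⊢-coherence d₂ d′))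
  where
  open SMC (Model.smc M)
  open Soundness S M
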